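{- Let $n\ge 1$ and let $\mathbf{u}=(u_1,\dots,u_n)\in\mathbb{R}^n$ be a nonzero vector with $0\le u_1\le\cdots\le u_n$. Then the normal fan of the parking function polytope $\mathrm{PF}(\mathbf{u})$ is a coarsening of the normal fan of $\mathrm{PF}(1,2,\dots,n)$. Equivalently, $\mathrm{PF}(\mathbf{u})$ is a deformation of $\mathrm{PF}(1,2,\dots,n)$.
   Context: For $\mathbf{u}=(u_1,\dots,u_n)$ with $0\le u_1\le\cdots\le u_n$, a vector $\mathbf{a}\in\mathbb{R}^n_{\ge0}$ with nondecreasing rearrangement $b_1\le\cdots\le b_n$ is a $\mathbf{u}$-parking function if $b_i\le u_i$ for all $i$. $\mathrm{PF}(\mathbf{u})\subset\mathbb{R}^n$ is the convex hull of all $\mathbf{u}$-parking functions (it is a polytope). For a nonempty face $F$ of a polytope $P\subset\mathbb{R}^n$, the normal cone is $\mathrm{ncone}(F,P)=\{\mathbf{w}\in\mathbb{R}^n : \mathbf{w}\cdot\mathbf{x}\ge\mathbf{w}\cdot\mathbf{y}\ \text{for all } \mathbf{x}\in F,\ \mathbf{y}\in P\}$. The normal fan $\Sigma(P)$ is the set of normal cones of $P$ at all its nonempty faces. $\Sigma(Q)$ is a coarsening of $\Sigma(P)$ if each cone in $\Sigma(Q)$ is a union of cones in $\Sigma(P)$; in that case $Q$ is called a deformation of $P$. -}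

module Defs where

open import Algebra.Bundles.Raw using (RawMonoid)
import Algebra.Definitions.RawMonoid as RawSum
open import Data.Fin as Fin using (Fin; toℕ)
open import Data.Fin.Permutation using (Permutation′; _⟨$⟩ʳ_)
open import Data.Integer using (+_)
open import Data.Nat as ℕ using (ℕ)
import Data.Nat.Properties as ℕₚ
open import Data.Product using (∃; ∃-syntax; _×_; _,_)
open import Data.Rational as ℚ using (ℚ; 0ℚ; 1ℚ; ½; ∣_∣)
import Data.Rational.Properties as ℚₚ
open import Data.Rational.Solver using (module +-*-Solver)
open import Data.Vec.Functional using (Vector)
open import Level using (0ℓ) renaming (suc to lsuc)
open import Relation.Binary.PropositionalEquality using (_≡_; refl; sym; trans; cong; cong₂; subst)
open import Relation.Unary using (Pred; _∈_; _≐_; _∩_; Satisfiable; ⋃)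

-- Real numbers are Cauchy sequences of rationals; equality of reals is _≈_
-- below, not _≡_.

IsCauchy : (ℕ → ℚ) → Set
IsCauchy s = ∀ ε → 0ℚ ℚ.< ε →
  ∃[ N ] ∀ m n → N ℕ.≤ m → N ℕ.≤ n → ∣ s m ℚ.- s n ∣ ℚ.< ε

record ℝ : Set where
  constructor mkℝ
  field
    seq    : ℕ → ℚ
    cauchy : IsCauchy seq

open ℝ public

infix 4 _≈_ _≤_

_≈_ : ℝ → ℝ → Set
x ≈ y = ∀ ε → 0ℚ ℚ.< ε → ∃[ N ] ∀ n → N ℕ.≤ n → ∣ seq x n ℚ.- seq y n ∣ ℚ.< ε

-- The slack ε is needed for _≤_ to respect _≈_.
_≤_ : ℝ → ℝ → Set
x ≤ y = ∀ ε → 0ℚ ℚ.< ε → ∃[ N ] ∀ n → N ℕ.≤ n → seq x n ℚ.< seq y n ℚ.+ ε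

private
  half-pos : ∀ {ε} → 0ℚ ℚ.< ε → 0ℚ ℚ.< ½ ℚ.* ε
  half-pos {ε} 0<ε = ℚₚ.positive⁻¹ (½ ℚ.* ε) {{ℚₚ.pos*pos⇒pos ½ ε {{ℚ.positive 0<ε}}}}

  half+half : ∀ ε → ½ ℚ.* ε ℚ.+ ½ ℚ.* ε ≡ ε
  half+half ε = trans (sym (ℚₚ.*-distribʳ-+ ε ½ ½)) (ℚₚ.*-identityˡ ε)

  const-cauchy : ∀ q → IsCauchy (λ _ → q)
  const-cauchy q ε 0<ε =
    0 , λ _ _ _ _ → subst (ℚ._< ε) (sym (cong ∣_∣ (ℚₚ.+-inverseʳ q))) 0<ε

  +-cauchy : ∀ {s t} → IsCauchy s → IsCauchy t → IsCauchy (λ n → s n ℚ.+ t n)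
  +-cauchy {s} {t} cs ct ε 0<ε with cs (½ ℚ.* ε) (half-pos 0<ε) | ct (½ ℚ.* ε) (half-pos 0<ε)
  ... | M , close-s | N , close-t = M ℕ.⊔ N , λ m n M⊔N≤m M⊔N≤n → begin-strict
    ∣ (s m ℚ.+ t m) ℚ.- (s n ℚ.+ t n) ∣
      ≡⟨ cong ∣_∣ (regroup (s m) (t m) (s n) (t n)) ⟩
    ∣ (s m ℚ.- s n) ℚ.+ (t m ℚ.- t n) ∣
      ≤⟨ ℚₚ.∣p+q∣≤∣p∣+∣q∣ (s m ℚ.- s n) (t m ℚ.- t n) ⟩
    ∣ s m ℚ.- s n ∣ ℚ.+ ∣ t m ℚ.- t n ∣
      <⟨ ℚₚ.+-mono-<
           (close-s m n (ℕₚ.m⊔n≤o⇒m≤o M N M⊔N≤m) (ℕₚ.m⊔n≤o⇒m≤o M N M⊔N≤n))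
           (close-t m n (ℕₚ.m⊔n≤o⇒n≤o M N M⊔N≤m) (ℕₚ.m⊔n≤o⇒n≤o M N M⊔N≤n)) ⟩
    ½ ℚ.* ε ℚ.+ ½ ℚ.* ε
      ≡⟨ half+half ε ⟩
    ε ∎
    where
    open ℚₚ.≤-Reasoning
    regroup : ∀ a b c d → (a ℚ.+ b) ℚ.- (c ℚ.+ d) ≡ (a ℚ.- c) ℚ.+ (b ℚ.- d)
    regroup = solve 4 (λ a b c d → (a :+ b) :- (c :+ d) := (a :- c) :+ (b :- d)) refl
      where open +-*-Solver

  eventually-bounded : ∀ {s} → IsCauchy s →
    ∃[ B ] ∃[ N ] 0ℚ ℚ.< B × (∀ n → N ℕ.≤ n → ∣ s n ∣ ℚ.< B)
  eventually-bounded {s} cs with cs 1ℚ (ℚₚ.positive⁻¹ 1ℚ)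
  ... | N , close = 1ℚ ℚ.+ ∣ s N ∣ , N ,
    ℚₚ.+-mono-<-≤ (ℚₚ.positive⁻¹ 1ℚ) (ℚₚ.0≤∣p∣ (s N)) , λ n N≤n → begin-strict
    ∣ s n ∣                        ≡⟨ cong ∣_∣ (regroup (s n) (s N)) ⟩
    ∣ (s n ℚ.- s N) ℚ.+ s N ∣      ≤⟨ ℚₚ.∣p+q∣≤∣p∣+∣q∣ (s n ℚ.- s N) (s N) ⟩
    ∣ s n ℚ.- s N ∣ ℚ.+ ∣ s N ∣    <⟨ ℚₚ.+-monoˡ-< ∣ s N ∣ (close n N N≤n ℕₚ.≤-refl) ⟩
    1ℚ ℚ.+ ∣ s N ∣                 ∎
    where
    open ℚₚ.≤-Reasoning
    regroup : ∀ a b → a ≡ (a ℚ.- b) ℚ.+ b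
    regroup = solve 2 (λ a b → a := (a :- b) :+ b) refl
      where open +-*-Solver

  scale : ∀ {B ε} → 0ℚ ℚ.< B → 0ℚ ℚ.< ε → ∃[ δ ] 0ℚ ℚ.< δ × B ℚ.* δ ≡ ε
  scale {B} {ε} 0<B 0<ε = B⁻¹ ℚ.* ε , ℚₚ.positive⁻¹ _ {{ℚₚ.pos*pos⇒pos B⁻¹ ε}} ,
    trans (sym (ℚₚ.*-assoc B B⁻¹ ε))
          (trans (cong (ℚ._* ε) (ℚₚ.*-inverseʳ B)) (ℚₚ.*-identityˡ ε))
    where
    instance
      B-pos = ℚ.positive 0<B
      ε-pos = ℚ.positive 0<ε
      B-nonZero = ℚₚ.pos⇒nonZero B
    B⁻¹ = ℚ.1/ B
    instance
      B⁻¹-pos = ℚₚ.1/pos⇒pos B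

  product-small : ∀ {B δ} a d → 0ℚ ℚ.< δ → ∣ a ∣ ℚ.< B → ∣ d ∣ ℚ.< δ → ∣ a ℚ.* d ∣ ℚ.< B ℚ.* δ
  product-small {B} {δ} a d 0<δ a<B d<δ = begin-strict
    ∣ a ℚ.* d ∣        ≡⟨ ℚₚ.∣p*q∣≡∣p∣*∣q∣ a d ⟩
    ∣ a ∣ ℚ.* ∣ d ∣    ≤⟨ ℚₚ.*-monoˡ-≤-nonNeg ∣ a ∣ {{ℚₚ.∣-∣-nonNeg a}} (ℚₚ.<⇒≤ d<δ) ⟩
    ∣ a ∣ ℚ.* δ        <⟨ ℚₚ.*-monoˡ-<-pos δ {{ℚ.positive 0<δ}} a<B ⟩
    B ℚ.* δ            ∎
    where open ℚₚ.≤-Reasoning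

  product-regroup : ∀ a b c d → a ℚ.* b ℚ.- c ℚ.* d ≡ a ℚ.* (b ℚ.- d) ℚ.+ d ℚ.* (a ℚ.- c)
  product-regroup = solve 4 (λ a b c d → a :* b :- c :* d := a :* (b :- d) :+ d :* (a :- c)) refl
    where open +-*-Solver

  product-close : ∀ {A B α β ε} a b c d → 0ℚ ℚ.< α → 0ℚ ℚ.< β →
    A ℚ.* α ≡ ½ ℚ.* ε → B ℚ.* β ≡ ½ ℚ.* ε →
    ∣ a ∣ ℚ.< A → ∣ d ∣ ℚ.< B → ∣ a ℚ.- c ∣ ℚ.< β → ∣ b ℚ.- d ∣ ℚ.< α →
    ∣ a ℚ.* b ℚ.- c ℚ.* d ∣ ℚ.< ε
  product-close {A} {B} {α} {β} {ε} a b c d 0<α 0<β Aα≡ε/2 Bβ≡ε/2 a<A d<B a-c<β b-d<α = begin-strict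
    ∣ a ℚ.* b ℚ.- c ℚ.* d ∣
      ≡⟨ cong ∣_∣ (product-regroup a b c d) ⟩
    ∣ a ℚ.* (b ℚ.- d) ℚ.+ d ℚ.* (a ℚ.- c) ∣
      ≤⟨ ℚₚ.∣p+q∣≤∣p∣+∣q∣ (a ℚ.* (b ℚ.- d)) (d ℚ.* (a ℚ.- c)) ⟩
    ∣ a ℚ.* (b ℚ.- d) ∣ ℚ.+ ∣ d ℚ.* (a ℚ.- c) ∣
      <⟨ ℚₚ.+-mono-< (product-small a (b ℚ.- d) 0<α a<A b-d<α)
                     (product-small d (a ℚ.- c) 0<β d<B a-c<β) ⟩
    A ℚ.* α ℚ.+ B ℚ.* β
      ≡⟨ cong₂ ℚ._+_ Aα≡ε/2 Bβ≡ε/2 ⟩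
    ½ ℚ.* ε ℚ.+ ½ ℚ.* ε
      ≡⟨ half+half ε ⟩
    ε ∎
    where open ℚₚ.≤-Reasoning

  *-cauchy : ∀ {s t} → IsCauchy s → IsCauchy t → IsCauchy (λ n → s n ℚ.* t n)
  *-cauchy {s} {t} cs ct ε 0<ε =
    let A , M , 0<A , s<A = eventually-bounded {s} cs
        B , N , 0<B , t<B = eventually-bounded {t} ct
        α , 0<α , Aα≡ε/2 = scale {A} {½ ℚ.* ε} 0<A (half-pos 0<ε)
        β , 0<β , Bβ≡ε/2 = scale {B} {½ ℚ.* ε} 0<B (half-pos 0<ε)
        M′ , close-s = cs β 0<β
        N′ , close-t = ct α 0<α
        K₁ = M ℕ.⊔ N
        K₂ = M′ ℕ.⊔ N′
    in K₁ ℕ.⊔ K₂ , λ m n K≤m K≤n →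
      let K₁≤m = ℕₚ.m⊔n≤o⇒m≤o K₁ K₂ K≤m
          K₁≤n = ℕₚ.m⊔n≤o⇒m≤o K₁ K₂ K≤n
          K₂≤m = ℕₚ.m⊔n≤o⇒n≤o K₁ K₂ K≤m
          K₂≤n = ℕₚ.m⊔n≤o⇒n≤o K₁ K₂ K≤n
      in product-close {A} {B} {α} {β} {ε} (s m) (t m) (s n) (t n) 0<α 0<β Aα≡ε/2 Bβ≡ε/2
           (s<A m (ℕₚ.m⊔n≤o⇒m≤o M N K₁≤m))
           (t<B n (ℕₚ.m⊔n≤o⇒n≤o M N K₁≤n))
           (close-s m n (ℕₚ.m⊔n≤o⇒m≤o M′ N′ K₂≤m) (ℕₚ.m⊔n≤o⇒m≤o M′ N′ K₂≤n))
           (close-t m n (ℕₚ.m⊔n≤o⇒n≤o M′ N′ K₂≤m) (ℕₚ.m⊔n≤o⇒n≤o M′ N′ K₂≤n))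

infixl 6 _+_
infixl 7 _*_

_+_ : ℝ → ℝ → ℝ
x + y = mkℝ (λ n → seq x n ℚ.+ seq y n) (+-cauchy {seq x} {seq y} (cauchy x) (cauchy y))

_*_ : ℝ → ℝ → ℝ
x * y = mkℝ (λ n → seq x n ℚ.* seq y n) (*-cauchy {seq x} {seq y} (cauchy x) (cauchy y))

fromℚ : ℚ → ℝ
fromℚ q = mkℝ (λ _ → q) (const-cauchy q)

0ℝ 1ℝ : ℝ
0ℝ = fromℚ 0ℚ
1ℝ = fromℚ 1ℚ

fromℕ : ℕ → ℝ
fromℕ k = fromℚ (+ k ℚ./ 1)

+-0-rawMonoid : RawMonoid 0ℓ 0ℓ
+-0-rawMonoid = record { Carrier = ℝ ; _≈_ = _≈_ ; _∙_ = _+_ ; ε = 0ℝ }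

open RawSum +-0-rawMonoid public using (sum)

ℝ^ : ℕ → Set
ℝ^ n = Vector ℝ n

Subset : ℕ → Set₁
Subset n = Pred (ℝ^ n) 0ℓ

infix 7 _·_

_·_ : ∀ {n} → ℝ^ n → ℝ^ n → ℝ
w · x = sum (λ i → w i * x i)

ConvexHull : ∀ {n} → Subset n → Subset n
ConvexHull {n} S x =
  ∃[ m ] ∃[ t ] ∃ λ (v : Fin m → ℝ^ n) →
    (∀ j → 0ℝ ≤ t j) × sum t ≈ 1ℝ × (∀ j → v j ∈ S) ×
    (∀ i → x i ≈ sum (λ j → t j * v j i))

-- Faces are cut out by valid inequalities w · x ≤ c; this includes P itself
-- (w = 0, c = 0) and ∅ (w = 0, c = 1).
_IsFaceOf_ : ∀ {n} → Subset n → Subset n → Set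
_IsFaceOf_ {n} F P = ∃ λ (w : ℝ^ n) → ∃ λ (c : ℝ) →
  (∀ {x} → x ∈ P → w · x ≤ c) × F ≐ (P ∩ λ x → w · x ≈ c)

ncone : ∀ {n} → Subset n → Subset n → Subset n
ncone F P w = ∀ {x y} → x ∈ F → y ∈ P → w · y ≤ w · x

-- Cones are subsets of ℝⁿ, so membership in the fan is up to _≐_.
NormalFan : ∀ {n} → Subset n → Pred (Subset n) (lsuc 0ℓ)
NormalFan P C = ∃ λ F → F IsFaceOf P × Satisfiable F × C ≐ ncone F P

_IsCoarseningOf_ : ∀ {n} → Pred (Subset n) (lsuc 0ℓ) → Pred (Subset n) (lsuc 0ℓ) → Set₁
_IsCoarseningOf_ {n} Σ₁ Σ₂ = ∀ {C} → C ∈ Σ₁ →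
  ∃ λ (I : Set) → ∃ λ (D : I → Subset n) → (∀ i → D i ∈ Σ₂) × C ≐ ⋃ I D

_IsDeformationOf_ : ∀ {n} → Subset n → Subset n → Set₁
Q IsDeformationOf P = NormalFan Q IsCoarseningOf NormalFan P

Nondecreasing : ∀ {n} → ℝ^ n → Set
Nondecreasing x = ∀ {i j} → i Fin.≤ j → x i ≤ x j

_IsRearrangementOf_ : ∀ {n} → ℝ^ n → ℝ^ n → Set
_IsRearrangementOf_ {n} b a = ∃ λ (π : Permutation′ n) → ∀ i → b i ≈ a (π ⟨$⟩ʳ i)

ParkingFunction : ∀ {n} → ℝ^ n → Subset n
ParkingFunction u a = (∀ i → 0ℝ ≤ a i) ×
  ∃[ b ] b IsRearrangementOf a × Nondecreasing b × (∀ i → b i ≤ u i)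

PF : ∀ {n} → ℝ^ n → Subset n
PF u = ConvexHull (ParkingFunction u)

oneTo : ∀ n → ℝ^ n
oneTo n i = fromℕ (ℕ.suc (toℕ i))

{-# OPTIONS --safe #-}
module Submission where

-- For w : ℝⁿ list the coordinates so that w increases, and let z(u) be the point
-- with i-th listed coordinate uᵢ where w > 0 and 0 elsewhere.  By the rearrangement
-- inequality z(u) maximises over PF(u), for every u at once, each functional that
-- is ≤ 0 off the chosen positions and nonnegative and increasing along them.
-- If w′ lies in the normal cone of the w-maximal face of PF(1,…,n), then w′ and
-- r w - w′ for large r are such functionals: being maximal at z(1,…,n) is tested
-- by deleting, adding or swapping coordinates, where strict inequalities for w
-- beat w′ once r is large and equalities for w force equalities for w′.
-- Hence w′ = r w - (r w - w′) is at least w′ · z(u) at every w-maximal point of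
-- PF(u), so a normal cone of PF(u) contains, with each w, the whole normal cone
-- of the w-maximal face of PF(1,…,n).

open import Algebra.Bundles using (CommutativeRing)
open import Data.Bool using (Bool; true; false; if_then_else_; not)
open import Data.Fin as Fin using (Fin; zero; suc; toℕ; punchIn; punchOut)
open import Data.Fin.Permutation as Perm using (Permutation′; _⟨$⟩ʳ_; _⟨$⟩ˡ_; _∘ₚ_)
import Data.Fin.Permutation.Components as PC
import Data.Fin.Properties as Finₚ
import Data.Integer as ℤ
import Data.Integer.Properties as ℤₚ
open import Data.Nat as ℕ using (ℕ)
import Data.Nat.Properties as ℕₚ
open import Data.Product using (∃; ∃-syntax; _×_; _,_; proj₁; proj₂)
open import Data.Rational as ℚ using (ℚ; 0ℚ; 1ℚ; ½)
import Data.Rational.Properties as ℚₚ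
import Data.Rational.Solver as ℚSolver
import Data.Rational.Unnormalised as ℚᵘ
import Data.Rational.Unnormalised.Properties as ℚᵘₚ
open import Data.Sum using (_⊎_; inj₁; inj₂; [_,_]′)
open import Data.Vec.Functional using (Vector; removeAt)
open import Function using (_∘_; id)
open import Level using (0ℓ)
open import Relation.Binary.Bundles using (DecTotalOrder)
open import Relation.Binary.Core using (Rel)
open import Relation.Binary.PropositionalEquality as ≡ using (_≡_; _≢_; subst)
import Relation.Binary.Reasoning.PartialOrder as PosetReasoning
open import Relation.Binary.Structures using (IsDecTotalOrder)
open import Relation.Nullary using (¬_; Dec; yes; no; does; contradiction)
open import Relation.Nullary.Decidable using (dec-true; dec-false)
open import Relation.Unary using (_∈_; _⊆_; _∩_)

-- Ordered commutative rings

record OrderedRing : Set₁ where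
  field
    commutativeRing : CommutativeRing 0ℓ 0ℓ
  open CommutativeRing commutativeRing public hiding (zero)
  infix 4 _≤_
  field
    _≤_ : Rel Carrier 0ℓ
    isDecTotalOrder : IsDecTotalOrder _≈_ _≤_
    +-mono-≤ : ∀ {x y z t} → x ≤ y → z ≤ t → x + z ≤ y + t
    *-nonneg : ∀ {x y} → 0# ≤ x → 0# ≤ y → 0# ≤ x * y
    -- Stands in for division.
    positive-unbounded : ∀ {x} → ¬ x ≤ 0# → ∃[ r ] 0# ≤ r × 1# ≤ r * x

-- Over an abstract carrier the two sides of `_≤_` and `_≈_` can be inferred by unification, unlike
-- over the concrete reals.
module OrderedRingProperties (R : OrderedRing) where
  open OrderedRing R
  open IsDecTotalOrder isDecTotalOrder public
    using (_≤?_; total; antisym)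
    renaming (refl to ≤-refl; reflexive to ≤-reflexive; trans to ≤-trans)
  open import Algebra.Properties.Ring ring using (-1*x≈-x)
  open import Algebra.Properties.Semiring.Sum semiring
  open import Algebra.Solver.Ring.NaturalCoefficients.Default commutativeSemiring
    using (solve; _:=_; _:+_; _:*_)

  decTotalOrder : DecTotalOrder 0ℓ 0ℓ 0ℓ
  decTotalOrder = record { isDecTotalOrder = isDecTotalOrder }

  open PosetReasoning (DecTotalOrder.poset decTotalOrder)

  private
    variable
      n : ℕ

  infix 7 _·_

  _·_ : Vector Carrier n → Vector Carrier n → Carrier
  w · x = sum (λ i → w i * x i)

  Nonnegative : Vector Carrier n → Set
  Nonnegative x = ∀ i → 0# ≤ x i

  Nondecreasing : Vector Carrier n → Set
  Nondecreasing x = ∀ {i j} → i Fin.≤ j → x i ≤ x j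

  -- Ordered ring arithmetic

  x≤y⇒0≤y-x : ∀ {x y} → x ≤ y → 0# ≤ y - x
  x≤y⇒0≤y-x {x} {y} x≤y = begin
    0#       ≈⟨ -‿inverseʳ x ⟨
    x - x    ≤⟨ +-mono-≤ x≤y ≤-refl ⟩
    y - x    ∎

  x+[y-x]≈y : ∀ x y → x + (y - x) ≈ y
  x+[y-x]≈y x y = begin-equality
    x + (y - x)    ≈⟨ +-congˡ (+-comm y (- x)) ⟩
    x + (- x + y)  ≈⟨ +-assoc x (- x) y ⟨
    x - x + y      ≈⟨ +-congʳ (-‿inverseʳ x) ⟩
    0# + y         ≈⟨ +-identityˡ y ⟩
    y              ∎

  +-cancelˡ-≤ : ∀ x {y z} → x + y ≤ x + z → y ≤ z
  +-cancelˡ-≤ x {y} {z} x+y≤x+z = begin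
    y              ≈⟨ shift y ⟨
    - x + (x + y)  ≤⟨ +-mono-≤ ≤-refl x+y≤x+z ⟩
    - x + (x + z)  ≈⟨ shift z ⟩
    z              ∎
    where
    shift : ∀ t → - x + (x + t) ≈ t
    shift t = trans (sym (+-assoc (- x) x t)) (trans (+-congʳ (-‿inverseˡ x)) (+-identityˡ t))

  +-cancelʳ-≤ : ∀ x {y z} → y + x ≤ z + x → y ≤ z
  +-cancelʳ-≤ x {y} {z} le = +-cancelˡ-≤ x (begin
    x + y  ≈⟨ +-comm x y ⟩
    y + x  ≤⟨ le ⟩
    z + x  ≈⟨ +-comm z x ⟩
    x + z  ∎)

  *-monoˡ-≤ : ∀ {x y z} → 0# ≤ x → y ≤ z → x * y ≤ x * z
  *-monoˡ-≤ {x} {y} {z} 0≤x y≤z = begin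
    x * y                  ≈⟨ +-identityʳ (x * y) ⟨
    x * y + 0#             ≤⟨ +-mono-≤ ≤-refl (*-nonneg 0≤x (x≤y⇒0≤y-x y≤z)) ⟩
    x * y + x * (z - y)    ≈⟨ distribˡ x y (z - y) ⟨
    x * (y + (z - y))      ≈⟨ *-congˡ (x+[y-x]≈y y z) ⟩
    x * z                  ∎

  *-monoʳ-≤ : ∀ {x y z} → 0# ≤ x → y ≤ z → y * x ≤ z * x
  *-monoʳ-≤ {x} {y} {z} 0≤x y≤z = begin
    y * x  ≈⟨ *-comm y x ⟩
    x * y  ≤⟨ *-monoˡ-≤ 0≤x y≤z ⟩
    x * z  ≈⟨ *-comm x z ⟩
    z * x  ∎

  ≰⇒≥ : ∀ {x y} → ¬ x ≤ y → y ≤ x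
  ≰⇒≥ {x} {y} x≰y with total x y
  ... | inj₁ x≤y = contradiction x≤y x≰y
  ... | inj₂ y≤x = y≤x

  -- If instead `y ≤ x`, then `x - y` is nonnegative, so `1# ≤ r * d` makes it at most
  -- `r * (d * (x - y))`, which is at most `0#`.
  *-cancelˡ-≤ : ∀ d {x y} → ¬ d ≤ 0# → d * x ≤ d * y → x ≤ y
  *-cancelˡ-≤ d {x} {y} d≰0 dx≤dy with total x y
  ... | inj₁ x≤y = x≤y
  ... | inj₂ y≤x with positive-unbounded d≰0
  ...   | r , 0≤r , 1≤rd = begin
    x            ≈⟨ x+[y-x]≈y y x ⟨
    y + (x - y)  ≤⟨ +-mono-≤ ≤-refl x-y≤0 ⟩
    y + 0#       ≈⟨ +-identityʳ y ⟩
    y            ∎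
    where
    d[x-y]≤0 : d * (x - y) ≤ 0#
    d[x-y]≤0 = +-cancelˡ-≤ (d * y) (begin
      d * y + d * (x - y)  ≈⟨ distribˡ d y (x - y) ⟨
      d * (y + (x - y))    ≈⟨ *-congˡ (x+[y-x]≈y y x) ⟩
      d * x                ≤⟨ dx≤dy ⟩
      d * y                ≈⟨ +-identityʳ (d * y) ⟨
      d * y + 0#           ∎)
    x-y≤0 : x - y ≤ 0#
    x-y≤0 = begin
      x - y              ≈⟨ *-identityʳ (x - y) ⟨
      (x - y) * 1#       ≤⟨ *-monoˡ-≤ (x≤y⇒0≤y-x y≤x) 1≤rd ⟩
      (x - y) * (r * d)  ≈⟨ solve 3 (λ z r d → z :* (r :* d) := r :* (d :* z)) refl (x - y) r d ⟩
      r * (d * (x - y))  ≤⟨ *-monoˡ-≤ 0≤r d[x-y]≤0 ⟩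
      r * 0#             ≈⟨ zeroʳ r ⟩
      0#                 ∎

  ForLarge : (Carrier → Set) → Set
  ForLarge P = ∃[ M ] 0# ≤ M × ∀ r → M ≤ r → P r

  -- `M + N` serves as a common threshold in place of a maximum, because `ForLarge` asks for
  -- nonnegative thresholds.
  for-large-× : ∀ {P Q : Carrier → Set} → ForLarge P → ForLarge Q → ForLarge (λ r → P r × Q r)
  for-large-× (M , 0≤M , p) (N , 0≤N , q) = M + N , +-nonneg 0≤M 0≤N , λ r M+N≤r →
      p r (≤-trans (M≤M+N 0≤N) M+N≤r) ,
      q r (≤-trans (≤-trans (M≤M+N 0≤M) (≤-reflexive (+-comm N M))) M+N≤r)
    where
    M≤M+N : ∀ {M N} → 0# ≤ N → M ≤ M + N
    M≤M+N {M} {N} 0≤N = begin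
      M       ≈⟨ +-identityʳ M ⟨
      M + 0#  ≤⟨ +-mono-≤ ≤-refl 0≤N ⟩
      M + N   ∎
    +-nonneg : ∀ {M N} → 0# ≤ M → 0# ≤ N → 0# ≤ M + N
    +-nonneg 0≤M 0≤N = ≤-trans 0≤M (M≤M+N 0≤N)

  for-large-∀ : {P : Fin n → Carrier → Set} →
    (∀ i → ForLarge (P i)) → ForLarge (λ r → ∀ i → P i r)
  for-large-∀ {ℕ.zero}  p = 0# , ≤-refl , λ _ _ ()
  for-large-∀ {ℕ.suc n} p with for-large-× (p zero) (for-large-∀ (p ∘ suc))
  ... | M , 0≤M , q = M , 0≤M , λ
    { r M≤r zero    → proj₁ (q r M≤r)
    ; r M≤r (suc i) → proj₂ (q r M≤r) i
    }

  -- The threshold is `c * s`, where `1# ≤ s * a` and `c` is the larger of `b` and zero.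
  multiples-exceed : ∀ {a} b → ¬ a ≤ 0# → ForLarge (λ r → b ≤ r * a)
  multiples-exceed {a} b a≰0 with positive-unbounded a≰0
  ... | s , 0≤s , 1≤sa = c * s , *-nonneg 0≤c 0≤s , λ r cs≤r → begin
    b            ≤⟨ b≤c ⟩
    c            ≈⟨ *-identityʳ c ⟨
    c * 1#       ≤⟨ *-monoˡ-≤ 0≤c 1≤sa ⟩
    c * (s * a)  ≈⟨ *-assoc c s a ⟨
    (c * s) * a  ≤⟨ *-monoʳ-≤ (≰⇒≥ a≰0) cs≤r ⟩
    r * a        ∎
    where
    upper : ∃[ c ] 0# ≤ c × b ≤ c
    upper with total b 0#
    ... | inj₁ b≤0 = 0# , ≤-refl , b≤0
    ... | inj₂ 0≤b = b , 0≤b , ≤-refl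
    c = proj₁ upper
    0≤c = proj₁ (proj₂ upper)
    b≤c = proj₂ (proj₂ upper)

  -- Sums

  sum-mono-≤ : {f g : Vector Carrier n} → (∀ i → f i ≤ g i) → sum f ≤ sum g
  sum-mono-≤ {ℕ.zero}  f≤g = ≤-refl
  sum-mono-≤ {ℕ.suc n} f≤g = +-mono-≤ (f≤g zero) (sum-mono-≤ (f≤g ∘ suc))

  -- The offsets `a` and `b` are there for `sum-differ₂`: they hold the first differing coordinate,
  -- already split off its sum.
  +-sum-differ₁ : ∀ {a b} {f g : Vector Carrier n} i → (∀ j → j ≢ i → f j ≈ g j) →
    a + sum f ≤ b + sum g → a + f i ≤ b + g i
  +-sum-differ₁ {ℕ.suc n} {a} {b} {f} {g} i same le = +-cancelʳ-≤ rest (begin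
    a + f i + rest                     ≈⟨ +-assoc a (f i) rest ⟩
    a + (f i + sum (removeAt f i))     ≈⟨ +-congˡ (sum-remove f) ⟨
    a + sum f                          ≤⟨ le ⟩
    b + sum g                          ≈⟨ +-congˡ (sum-remove g) ⟩
    b + (g i + sum (removeAt g i))     ≈⟨ +-congˡ (+-congˡ (sum-cong-≋ λ j →
                                            sym (same (punchIn i j) (Finₚ.punchInᵢ≢i i j)))) ⟩
    b + (g i + rest)                   ≈⟨ +-assoc b (g i) rest ⟨
    b + g i + rest                     ∎)
    where rest = sum (removeAt f i)

  sum-differ₁ : {f g : Vector Carrier n} → ∀ i → (∀ j → j ≢ i → f j ≈ g j) →
    sum f ≤ sum g → f i ≤ g i
  sum-differ₁ i same le = +-cancelˡ-≤ 0# (+-sum-differ₁ i same (+-mono-≤ ≤-refl le))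

  sum-differ₂ : {f g : Vector Carrier n} → ∀ {i j} → i ≢ j →
    (∀ k → k ≢ i → k ≢ j → f k ≈ g k) → sum f ≤ sum g → f i + f j ≤ g i + g j
  sum-differ₂ {ℕ.suc n} {f} {g} {i} {j} i≢j same le =
    subst (λ k → f i + f k ≤ g i + g k) (Finₚ.punchIn-punchOut i≢j)
      (+-sum-differ₁ {f = removeAt f i} {g = removeAt g i} (punchOut i≢j)
        (λ k k≢ → same (punchIn i k) (Finₚ.punchInᵢ≢i i k) (λ k≡j → k≢
          (Finₚ.punchIn-injective i k (punchOut i≢j)
            (≡.trans k≡j (≡.sym (Finₚ.punchIn-punchOut i≢j))))))
        (begin
          f i + sum (removeAt f i)  ≈⟨ sum-remove f ⟨
          sum f                     ≤⟨ le ⟩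
          sum g                     ≈⟨ sum-remove g ⟩
          g i + sum (removeAt g i)  ∎))

  ·-permute : ∀ (w x : Vector Carrier n) (π : Permutation′ n) →
    w · x ≈ (w ∘ (π ⟨$⟩ʳ_)) · (x ∘ (π ⟨$⟩ʳ_))
  ·-permute w x π = sum-permute (λ i → w i * x i) π

  ·-permuteˡ : ∀ (w x : Vector Carrier n) (π : Permutation′ n) →
    w · (x ∘ (π ⟨$⟩ˡ_)) ≈ (w ∘ (π ⟨$⟩ʳ_)) · x
  ·-permuteˡ w x π = begin-equality
    w · (x ∘ (π ⟨$⟩ˡ_))
      ≈⟨ ·-permute w (x ∘ (π ⟨$⟩ˡ_)) π ⟩
    (w ∘ (π ⟨$⟩ʳ_)) · (x ∘ (π ⟨$⟩ˡ_) ∘ (π ⟨$⟩ʳ_))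
      ≈⟨ sum-cong-≋ (λ i → *-congˡ {w (π ⟨$⟩ʳ i)} (reflexive (≡.cong x (Perm.inverseˡ π)))) ⟩
    (w ∘ (π ⟨$⟩ʳ_)) · x ∎

  -- Differences `r w - w′` are written with the factor `- 1#` so that they are instances of this
  -- combination.
  ·-linear : ∀ r s (v w x : Vector Carrier n) →
    (λ i → r * v i + s * w i) · x ≈ r * (v · x) + s * (w · x)
  ·-linear r s v w x = begin-equality
    sum (λ i → (r * v i + s * w i) * x i)
      ≈⟨ sum-cong-≋ (λ i → solve 5 (λ r s v w x →
           (r :* v :+ s :* w) :* x := r :* (v :* x) :+ s :* (w :* x)) refl r s (v i) (w i) (x i)) ⟩
    sum (λ i → r * (v i * x i) + s * (w i * x i))
      ≈⟨ ∑-distrib-+ (λ i → r * (v i * x i)) (λ i → s * (w i * x i)) ⟩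
    sum (λ i → r * (v i * x i)) + sum (λ i → s * (w i * x i))
      ≈⟨ +-cong (*-distribˡ-sum r (λ i → v i * x i)) (*-distribˡ-sum s (λ i → w i * x i)) ⟨
    r * (v · x) + s * (w · x) ∎

  -- Exchanging the two sums exhibits `w · x` as the weighted average of the values `w · v j`.
  convex-bound : ∀ {m c} (w x : Vector Carrier n) (t : Vector Carrier m)
    (v : Fin m → Vector Carrier n) → Nonnegative t → sum t ≈ 1# →
    (∀ i → x i ≈ sum (λ j → t j * v j i)) → (∀ j → w · v j ≤ c) → w · x ≤ c
  convex-bound {c = c} w x t v 0≤t ∑t≈1 x≈∑tv wv≤c = begin
    sum (λ i → w i * x i)
      ≈⟨ sum-cong-≋ (λ i → trans (*-congˡ (x≈∑tv i)) (*-distribˡ-sum (w i) (λ j → t j * v j i))) ⟩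
    sum (λ i → sum (λ j → w i * (t j * v j i)))
      ≈⟨ ∑-comm (λ i j → w i * (t j * v j i)) ⟩
    sum (λ j → sum (λ i → w i * (t j * v j i)))
      ≈⟨ sum-cong-≋ (λ j → trans
           (sum-cong-≋ (λ i → solve 3 (λ w t v → w :* (t :* v) := t :* (w :* v)) refl (w i) (t j) (v j i)))
           (sym (*-distribˡ-sum (t j) (λ i → w i * v j i)))) ⟩
    sum (λ j → t j * (w · v j))
      ≤⟨ sum-mono-≤ (λ j → *-monoˡ-≤ (0≤t j) (wv≤c j)) ⟩
    sum (λ j → t j * c)
      ≈⟨ *-distribʳ-sum c t ⟨
    sum t * c
      ≈⟨ *-congʳ ∑t≈1 ⟩
    1# * c
      ≈⟨ *-identityˡ c ⟩
    c ∎

  -- Sorting and rearrangement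

  argmin : ∀ (x : Vector Carrier (ℕ.suc n)) → ∃[ m ] ∀ i → x m ≤ x i
  argmin {ℕ.zero}  x = zero , λ { zero → ≤-refl }
  argmin {ℕ.suc n} x with argmin (x ∘ suc)
  ... | m , m-min with total (x zero) (x (suc m))
  ...   | inj₁ x₀≤xₘ = zero , λ { zero → ≤-refl ; (suc i) → ≤-trans x₀≤xₘ (m-min i) }
  ...   | inj₂ xₘ≤x₀ = suc m , λ { zero → xₘ≤x₀ ; (suc i) → m-min i }

  punchIn≤suc : ∀ (i : Fin (ℕ.suc n)) j → punchIn i j Fin.≤ suc j
  punchIn≤suc zero    j       = ℕₚ.≤-refl
  punchIn≤suc (suc i) zero    = ℕ.z≤n
  punchIn≤suc (suc i) (suc j) = ℕ.s≤s (punchIn≤suc i j)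

  -- Selection sort. Its last component is what makes every nonnegative vector lying entrywise below
  -- `u` a parking function.
  sort : ∀ (x : Vector Carrier n) → ∃ λ (σ : Permutation′ n) →
    Nondecreasing (x ∘ (σ ⟨$⟩ʳ_)) ×
    (∀ {u} → Nondecreasing u → (∀ i → x i ≤ u i) → ∀ i → x (σ ⟨$⟩ʳ i) ≤ u i)
  sort {ℕ.zero}  x = Perm.id , (λ { {()} }) , λ _ _ ()
  sort {ℕ.suc n} x with argmin x
  ... | m , m-min with sort (x ∘ punchIn m)
  ...   | σ , σ-sorts , σ-below = Perm.insert zero m σ , sorts , below
    where
    sorts : Nondecreasing (x ∘ (Perm.insert zero m σ ⟨$⟩ʳ_))
    sorts {zero}  {j}     _           = m-min _
    sorts {suc i} {suc j} (ℕ.s≤s i≤j) = σ-sorts i≤j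
    below : ∀ {u} → Nondecreasing u → (∀ i → x i ≤ u i) →
      ∀ i → x (Perm.insert zero m σ ⟨$⟩ʳ i) ≤ u i
    below u-mono x≤u zero    = ≤-trans (m-min zero) (x≤u zero)
    -- Once the minimum is removed, the entry in place `j` of the rest came from an index at most
    -- `suc j`, so it is at most `u (suc j)`.
    below {u} u-mono x≤u (suc i) = σ-below {u ∘ suc} (λ i≤j → u-mono (ℕ.s≤s i≤j))
      (λ j → ≤-trans (x≤u (punchIn m j)) (u-mono (punchIn≤suc m j))) i

  -- Moving the entry b₀ from position m to position 0 is compensated by
  -- ∑ p = p m + ∑ p ∘ punchIn m = p 0 + ∑ p ∘ suc.
  rearrangement : ∀ (p b : Vector Carrier n) (τ : Permutation′ n) →
    Nondecreasing p → Nondecreasing b → p · (b ∘ (τ ⟨$⟩ʳ_)) ≤ p · b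
  rearrangement {ℕ.zero}  p b τ p-mono b-mono = ≤-refl
  rearrangement {ℕ.suc n} p b τ p-mono b-mono = begin
    sum (λ i → p i * b (τ ⟨$⟩ʳ i))
      ≈⟨ sum-remove {i = m} (λ i → p i * b (τ ⟨$⟩ʳ i)) ⟩
    p m * b (τ ⟨$⟩ʳ m) + sum (λ i → p (punchIn m i) * b (τ ⟨$⟩ʳ punchIn m i))
      ≈⟨ +-cong (*-congˡ {p m} (reflexive (≡.cong b (Perm.inverseʳ τ))))
           (sum-cong-≋ λ i → *-congˡ {p (punchIn m i)}
             (reflexive (≡.cong b (Perm.punchIn-permute′ τ zero i)))) ⟩
    p m * b zero + p′ · (b ∘ suc ∘ (τ′ ⟨$⟩ʳ_))
      ≤⟨ +-mono-≤ ≤-refl (rearrangement p′ (b ∘ suc) τ′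
           (λ {i} {j} i≤j → p-mono (Finₚ.punchIn-mono-≤ m i j i≤j)) (λ i≤j → b-mono (ℕ.s≤s i≤j))) ⟩
    p m * b zero + p′ · (b ∘ suc)
      ≤⟨ +-cancelʳ-≤ (sum (p ∘ suc) * b zero) compensate ⟩
    p zero * b zero + (p ∘ suc) · (b ∘ suc) ∎
    where
    m = τ ⟨$⟩ˡ zero
    τ′ = Perm.remove m τ
    p′ = p ∘ punchIn m
    -- The two sides differ by `(q - p) * (c - b)`.
    exchange : ∀ {p q b c} → p ≤ q → b ≤ c → p * c + q * b ≤ q * c + p * b
    exchange {p} {q} {b} {c} p≤q b≤c = begin
      p * c + q * b
        ≈⟨ +-congˡ (*-congʳ (x+[y-x]≈y p q)) ⟨
      p * c + (p + (q - p)) * b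
        ≈⟨ solve 4 (λ p d b c → p :* c :+ (p :+ d) :* b := p :* c :+ p :* b :+ d :* b)
             refl p (q - p) b c ⟩
      p * c + p * b + (q - p) * b
        ≤⟨ +-mono-≤ ≤-refl (*-monoˡ-≤ (x≤y⇒0≤y-x p≤q) b≤c) ⟩
      p * c + p * b + (q - p) * c
        ≈⟨ solve 4 (λ p d b c → p :* c :+ p :* b :+ d :* c := (p :+ d) :* c :+ p :* b)
             refl p (q - p) b c ⟩
      (p + (q - p)) * c + p * b
        ≈⟨ +-congʳ (*-congʳ (x+[y-x]≈y p q)) ⟩
      q * c + p * b ∎
    sums : p′ · (b ∘ suc) + sum (p ∘ suc) * b zero ≤ (p ∘ suc) · (b ∘ suc) + sum p′ * b zero
    sums = begin
      p′ · (b ∘ suc) + sum (p ∘ suc) * b zero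
        ≈⟨ +-congˡ (*-distribʳ-sum (b zero) (p ∘ suc)) ⟩
      p′ · (b ∘ suc) + sum (λ i → p (suc i) * b zero)
        ≈⟨ ∑-distrib-+ (λ i → p′ i * b (suc i)) (λ i → p (suc i) * b zero) ⟨
      sum (λ i → p′ i * b (suc i) + p (suc i) * b zero)
        ≤⟨ sum-mono-≤ (λ i → exchange (p-mono (punchIn≤suc m i)) (b-mono ℕ.z≤n)) ⟩
      sum (λ i → p (suc i) * b (suc i) + p′ i * b zero)
        ≈⟨ ∑-distrib-+ (λ i → p (suc i) * b (suc i)) (λ i → p′ i * b zero) ⟩
      (p ∘ suc) · (b ∘ suc) + sum (λ i → p′ i * b zero)
        ≈⟨ +-congˡ (*-distribʳ-sum (b zero) p′) ⟨
      (p ∘ suc) · (b ∘ suc) + sum p′ * b zero ∎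
    compensate : p m * b zero + p′ · (b ∘ suc) + sum (p ∘ suc) * b zero ≤
                 p zero * b zero + (p ∘ suc) · (b ∘ suc) + sum (p ∘ suc) * b zero
    compensate = begin
      p m * b zero + p′ · (b ∘ suc) + sum (p ∘ suc) * b zero
        ≈⟨ +-assoc _ _ _ ⟩
      p m * b zero + (p′ · (b ∘ suc) + sum (p ∘ suc) * b zero)
        ≤⟨ +-mono-≤ ≤-refl sums ⟩
      p m * b zero + ((p ∘ suc) · (b ∘ suc) + sum p′ * b zero)
        ≈⟨ solve 4 (λ x b y z → x :* b :+ (y :+ z :* b) := (x :+ z) :* b :+ y)
             refl (p m) (b zero) ((p ∘ suc) · (b ∘ suc)) (sum p′) ⟩
      (p m + sum p′) * b zero + (p ∘ suc) · (b ∘ suc)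
        ≈⟨ +-congʳ (*-congʳ (sum-remove p)) ⟨
      (p zero + sum (p ∘ suc)) * b zero + (p ∘ suc) · (b ∘ suc)
        ≈⟨ solve 4 (λ x b y z → (x :+ z) :* b :+ y := x :* b :+ y :+ z :* b)
             refl (p zero) (b zero) ((p ∘ suc) · (b ∘ suc)) (sum (p ∘ suc)) ⟩
      p zero * b zero + (p ∘ suc) · (b ∘ suc) + sum (p ∘ suc) * b zero ∎

  -- Parking functions

  -- The rearrangement is kept as a permutation of `a` itself, so that no separate vector equal to
  -- it up to `_≈_` has to be carried along.
  IsParking : Vector Carrier n → Vector Carrier n → Set
  IsParking {n} u a = Nonnegative a × ∃ λ (σ : Permutation′ n) →
    Nondecreasing (a ∘ (σ ⟨$⟩ʳ_)) × (∀ i → a (σ ⟨$⟩ʳ i) ≤ u i)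

  parking-permute : ∀ {u a : Vector Carrier n} (ρ : Permutation′ n) →
    IsParking u a → IsParking u (a ∘ (ρ ⟨$⟩ʳ_))
  parking-permute {a = a} ρ (0≤a , σ , sorted , below) =
    0≤a ∘ (ρ ⟨$⟩ʳ_) , σ ∘ₚ Perm.flip ρ ,
    (λ {i} {j} i≤j → ≡.subst₂ _≤_ (unpermute i) (unpermute j) (sorted i≤j)) ,
    (λ i → subst (_≤ _) (unpermute i) (below i))
    where
    unpermute : ∀ i → a (σ ⟨$⟩ʳ i) ≡ a (ρ ⟨$⟩ʳ (ρ ⟨$⟩ˡ (σ ⟨$⟩ʳ i)))
    unpermute i = ≡.cong a (≡.sym (Perm.inverseʳ ρ))

  below⇒parking : ∀ {u a : Vector Carrier n} → Nondecreasing u → Nonnegative a →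
    (∀ i → a i ≤ u i) → IsParking u a
  below⇒parking {a = a} u-mono 0≤a a≤u with sort a
  ... | σ , sorted , below = 0≤a , σ , sorted , below u-mono a≤u

  -- Rearrangement aligns the increasing `p` with the sorted `a`; nonnegativity of `p` then allows
  -- each sorted entry to be replaced by its bound in `u`.
  ·-parking-≤ : ∀ {p u a : Vector Carrier n} → Nonnegative p → Nondecreasing p →
    IsParking u a → p · a ≤ p · u
  ·-parking-≤ {p = p} {u} {a} 0≤p p-mono (0≤a , σ , sorted , below) = begin
    p · a
      ≈⟨ sum-cong-≋ (λ i → *-congˡ {p i} (reflexive (≡.cong a (≡.sym (Perm.inverseʳ σ))))) ⟩
    p · (a ∘ (σ ⟨$⟩ʳ_) ∘ (σ ⟨$⟩ˡ_))
      ≤⟨ rearrangement p (a ∘ (σ ⟨$⟩ʳ_)) (Perm.flip σ) p-mono sorted ⟩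
    p · (a ∘ (σ ⟨$⟩ʳ_))
      ≤⟨ sum-mono-≤ (λ i → *-monoˡ-≤ (0≤p i) (below i)) ⟩
    p · u ∎

  -- Vertices of the parking function polytope, up to a permutation of the coordinates

  truncate : Vector Carrier n → (Fin n → Bool) → Vector Carrier n
  truncate u S i = if S i then u i else 0#

  UpClosed : (Fin n → Bool) → Set
  UpClosed S = ∀ {i j} → i Fin.≤ j → S i ≡ true → S j ≡ true

  -- The functionals maximised at truncate u S for every nondecreasing u ≥ 0.
  record Compatible (S : Fin n → Bool) (v : Vector Carrier n) : Set where
    field
      nonpositive : ∀ {i} → S i ≡ false → v i ≤ 0#
      nonnegative : ∀ {i} → S i ≡ true → 0# ≤ v i
      monotone    : ∀ {i j} → i Fin.≤ j → S i ≡ true → v i ≤ v j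

  module _ {u : Vector Carrier n} (0≤u : Nonnegative u) where

    truncate-nonneg : ∀ S → Nonnegative (truncate u S)
    truncate-nonneg S i with S i
    ... | true  = 0≤u i
    ... | false = ≤-refl

    truncate-parking : Nondecreasing u → ∀ S → IsParking u (truncate u S)
    truncate-parking u-mono S = below⇒parking u-mono (truncate-nonneg S) below
      where
      below : ∀ i → truncate u S i ≤ u i
      below i with S i
      ... | true  = ≤-refl
      ... | false = 0≤u i

  -- Setting `v` to zero off `S` drops only nonpositive terms and leaves a nonnegative vector,
  -- nondecreasing because `S` is an upper set. The truncation then moves from `v` to `u` inside the
  -- dot product.
  compatible⇒maximal : ∀ {S} {v u a : Vector Carrier n} → UpClosed S → Compatible S v →
    IsParking u a → v · a ≤ v · truncate u S
  compatible⇒maximal {S = S} {v} {u} {a} up compatible parking = begin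
    v · a                ≤⟨ sum-mono-≤ drop ⟩
    truncate v S · a     ≤⟨ ·-parking-≤ nonneg mono parking ⟩
    truncate v S · u     ≈⟨ sum-cong-≋ move ⟩
    v · truncate u S     ∎
    where
    open Compatible compatible
    drop : ∀ i → v i * a i ≤ truncate v S i * a i
    drop i with S i in Si
    ... | true  = ≤-refl
    ... | false = *-monoʳ-≤ (proj₁ parking i) (nonpositive Si)
    move : ∀ i → truncate v S i * u i ≈ v i * truncate u S i
    move i with S i
    ... | true  = refl
    ... | false = trans (zeroˡ (u i)) (sym (zeroʳ (v i)))
    nonneg : Nonnegative (truncate v S)
    nonneg i with S i in Si
    ... | true  = nonnegative Si
    ... | false = ≤-refl
    mono : Nondecreasing (truncate v S)
    mono {i} {j} i≤j with S i in Si
    ... | false = nonneg j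
    ... | true rewrite up i≤j Si = monotone i≤j Si

  compatible-sign : ∀ (v : Vector Carrier n) → Nondecreasing v →
    ∃[ S ] UpClosed S × Compatible S v
  compatible-sign v v-mono = S , up , record
    { nonpositive = nonpositive
    ; nonnegative = ≰⇒≥ ∘ positive
    ; monotone    = λ i≤j _ → v-mono i≤j
    }
    where
    S = λ i → not (does (v i ≤? 0#))
    nonpositive : ∀ {i} → S i ≡ false → v i ≤ 0#
    nonpositive {i} _ with v i ≤? 0#
    ... | yes vi≤0 = vi≤0
    positive : ∀ {i} → S i ≡ true → ¬ v i ≤ 0#
    positive {i} _ with v i ≤? 0#
    ... | no vi≰0 = vi≰0
    up : UpClosed S
    up {i} {j} i≤j Si with v j ≤? 0#
    ... | yes vj≤0 = contradiction (≤-trans (v-mono i≤j) vj≤0) (positive Si)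
    ... | no  _    = ≡.refl

  -- Local maximality for strictly increasing vectors

  record StrictlyIncreasing (e : Vector Carrier n) : Set where
    field
      positive   : ∀ i → ¬ e i ≤ 0#
      -- Strictness is recorded as an explicit gap `d`, the factor that `*-cancelˡ-≤` removes when
      -- two coordinates are swapped.
      increasing : ∀ {i j} → i Fin.< j → ∃[ d ] ¬ d ≤ 0# × e j ≈ e i + d

    e-nonneg : Nonnegative e
    e-nonneg i = ≰⇒≥ (positive i)

    e-mono : Nondecreasing e
    e-mono {i} {j} i≤j with i Finₚ.≟ j
    ... | yes ≡.refl = ≤-refl
    ... | no  i≢j with increasing (Finₚ.≤∧≢⇒< i≤j i≢j)
    ...   | d , d≰0 , ej≈ei+d = begin
      e i       ≈⟨ +-identityʳ (e i) ⟨
      e i + 0#  ≤⟨ +-mono-≤ ≤-refl (≰⇒≥ d≰0) ⟩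
      e i + d   ≈⟨ ej≈ei+d ⟨
      e j       ∎

  -- Covers deleting and adding a position at once. The result may fail to be an upper set, which is
  -- harmless: `truncate-parking` accepts every subset.
  toggle : Fin n → (Fin n → Bool) → Fin n → Bool
  toggle i S j = if does (j Finₚ.≟ i) then not (S j) else S j

  toggle-at : ∀ i (S : Fin n → Bool) → toggle i S i ≡ not (S i)
  toggle-at i S rewrite dec-true (i Finₚ.≟ i) ≡.refl = ≡.refl

  toggle-away : ∀ i (S : Fin n → Bool) {j} → j ≢ i → toggle i S j ≡ S j
  toggle-away i S {j} j≢i rewrite dec-false (j Finₚ.≟ i) j≢i = ≡.refl

  transpose-left : ∀ (i j : Fin n) → PC.transpose i j i ≡ j
  transpose-left i j rewrite dec-true (i Finₚ.≟ i) ≡.refl = ≡.refl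

  transpose-right : ∀ (i j : Fin n) → i ≢ j → PC.transpose i j j ≡ i
  transpose-right i j i≢j
    rewrite dec-false (j Finₚ.≟ i) (i≢j ∘ ≡.sym) | dec-true (j Finₚ.≟ j) ≡.refl = ≡.refl

  transpose-away : ∀ (i j : Fin n) {k} → k ≢ i → k ≢ j → PC.transpose i j k ≡ k
  transpose-away i j {k} k≢i k≢j
    rewrite dec-false (k Finₚ.≟ i) k≢i | dec-false (k Finₚ.≟ j) k≢j = ≡.refl

  module _ {e : Vector Carrier n} (e-strict : StrictlyIncreasing e)
           {S : Fin n → Bool} (up : UpClosed S) where
    open StrictlyIncreasing e-strict

    private
      z = truncate e S

    -- A converse of `compatible⇒maximal` that tests only finitely many points. A toggle changes
    -- only the `i`-th term, whose factor `e i > 0` cancels to give the sign of `v i`; a swap inside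
    -- `S` compares `v i` with `v j` through the gap between `e i` and `e j`.
    locally-maximal⇒compatible : ∀ {v} →
      (∀ i → v · truncate e (toggle i S) ≤ v · z) →
      (∀ i j → v · (z ∘ PC.transpose i j) ≤ v · z) →
      Compatible S v
    locally-maximal⇒compatible {v} toggles swaps = record
      { nonpositive = nonpositive ; nonnegative = nonnegative ; monotone = monotone }
      where
      toggled : ∀ i → v i * (if not (S i) then e i else 0#) ≤ v i * z i
      toggled i = subst (λ b → v i * (if b then e i else 0#) ≤ v i * z i) (toggle-at i S)
        (sum-differ₁ i (λ j j≢i → reflexive
          (≡.cong (λ b → v j * (if b then e j else 0#)) (toggle-away i S j≢i))) (toggles i))
      nonpositive : ∀ {i} → S i ≡ false → v i ≤ 0#
      nonpositive {i} Si with toggled i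
      ... | le rewrite Si = *-cancelˡ-≤ (e i) (positive i) (begin
        e i * v i  ≈⟨ *-comm (e i) (v i) ⟩
        v i * e i  ≤⟨ le ⟩
        v i * 0#   ≈⟨ trans (zeroʳ (v i)) (sym (zeroʳ (e i))) ⟩
        e i * 0#   ∎)
      nonnegative : ∀ {i} → S i ≡ true → 0# ≤ v i
      nonnegative {i} Si with toggled i
      ... | le rewrite Si = *-cancelˡ-≤ (e i) (positive i) (begin
        e i * 0#   ≈⟨ trans (zeroʳ (v i)) (sym (zeroʳ (e i))) ⟨
        v i * 0#   ≤⟨ le ⟩
        v i * e i  ≈⟨ *-comm (e i) (v i) ⟨
        e i * v i  ∎)
      z-on : ∀ {i} → S i ≡ true → z i ≡ e i
      z-on Si rewrite Si = ≡.refl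
      monotone : ∀ {i j} → i Fin.≤ j → S i ≡ true → v i ≤ v j
      monotone {i} {j} i≤j Si with i Finₚ.≟ j
      ... | yes ≡.refl = ≤-refl
      ... | no  i≢j with increasing (Finₚ.≤∧≢⇒< i≤j i≢j)
      -- With `e j` written as `e i + d`, both sides of the swap inequality contain
      -- `v i * e i + v j * e i`; what is left is `d * v i ≤ d * v j`.
      ...   | d , d≰0 , ej≈ei+d = *-cancelˡ-≤ d d≰0 (+-cancelˡ-≤ (v i * e i + v j * e i) (begin
        v i * e i + v j * e i + d * v i
          ≈⟨ solve 4 (λ a b x d → a :* x :+ b :* x :+ d :* a := a :* (x :+ d) :+ b :* x)
               refl (v i) (v j) (e i) d ⟩
        v i * (e i + d) + v j * e i
          ≈⟨ +-congʳ (*-congˡ ej≈ei+d) ⟨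
        v i * e j + v j * e i
          ≡⟨ ≡.cong₂ (λ x y → v i * x + v j * y)
               (≡.trans (≡.cong z (transpose-left i j)) (z-on (up i≤j Si)))
               (≡.trans (≡.cong z (transpose-right i j i≢j)) (z-on Si)) ⟨
        v i * z (PC.transpose i j i) + v j * z (PC.transpose i j j)
          ≤⟨ sum-differ₂ i≢j (λ k k≢i k≢j → reflexive
               (≡.cong (λ l → v k * z l) (transpose-away i j k≢i k≢j))) (swaps i j) ⟩
        v i * z i + v j * z j
          ≡⟨ ≡.cong₂ (λ x y → v i * x + v j * y) (z-on Si) (z-on (up i≤j Si)) ⟩
        v i * e i + v j * e j
          ≈⟨ +-congˡ (*-congˡ ej≈ei+d) ⟩
        v i * e i + v j * (e i + d)
          ≈⟨ solve 4 (λ a b x d → a :* x :+ b :* (x :+ d) := a :* x :+ b :* x :+ d :* b)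
               refl (v i) (v j) (e i) d ⟩
        v i * e i + v j * e i + d * v j ∎))

    -- At a vertex where v′ is constant on the face of v, a large multiple of v
    -- absorbs v′; the local criterion leaves only finitely many conditions.
    absorb : ∀ {v v′} → Compatible S v →
      (∀ {y} → IsParking e y → v′ · y ≤ v′ · z) →
      (∀ {y} → IsParking e y → v · y ≈ v · z → v′ · z ≤ v′ · y) →
      Compatible S v′ × ∃[ r ] 0# ≤ r × Compatible S (λ i → r * v i + - 1# * v′ i)
    absorb {v} {v′} compatible v′-maximal v′-constant =
      locally-maximal⇒compatible
        (λ i → v′-maximal (toggle-parking i)) (λ i j → v′-maximal (swap-parking i j)) ,
      r , 0≤r , locally-maximal⇒compatible (proj₁ (large r ≤-refl)) (proj₂ (large r ≤-refl))
      where
      z-parking : IsParking e z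
      z-parking = truncate-parking e-nonneg e-mono S
      toggle-parking : ∀ i → IsParking e (truncate e (toggle i S))
      toggle-parking i = truncate-parking e-nonneg e-mono (toggle i S)
      swap-parking : ∀ i j → IsParking e (z ∘ PC.transpose i j)
      swap-parking i j = parking-permute (Perm.transpose i j) z-parking

      -- If `v` drops strictly from `z` to `y`, multiples of the drop exceed any given number.
      -- Otherwise `y` ties with `z`, so `v′-constant` makes the left side nonpositive and any
      -- `r ≥ 0` will do.
      gap : ∀ {y} → IsParking e y → ForLarge (λ r → v′ · z - v′ · y ≤ r * (v · z - v · y))
      gap {y} y-parking with v · z ≤? v · y
      ... | no  vz≰vy = multiples-exceed (v′ · z - v′ · y) λ vz-vy≤0 → vz≰vy (begin
        v · z                      ≈⟨ x+[y-x]≈y (v · y) (v · z) ⟨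
        v · y + (v · z - v · y)    ≤⟨ +-mono-≤ ≤-refl vz-vy≤0 ⟩
        v · y + 0#                 ≈⟨ +-identityʳ (v · y) ⟩
        v · y                      ∎)
      ... | yes vz≤vy = 0# , ≤-refl , λ r 0≤r → begin
        v′ · z - v′ · y            ≤⟨ +-mono-≤ (v′-constant y-parking vy≈vz) ≤-refl ⟩
        v′ · y - v′ · y            ≈⟨ -‿inverseʳ (v′ · y) ⟩
        0#                         ≤⟨ *-nonneg 0≤r (x≤y⇒0≤y-x (compatible⇒maximal up compatible y-parking)) ⟩
        r * (v · z - v · y)        ∎
        where vy≈vz = antisym (compatible⇒maximal up compatible y-parking) vz≤vy

      beats : ∀ {y} → IsParking e y → ForLarge (λ r →
        (λ i → r * v i + - 1# * v′ i) · y ≤ (λ i → r * v i + - 1# * v′ i) · z)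
      beats {y} y-parking with gap y-parking
      ... | M , 0≤M , large = M , 0≤M , λ r M≤r → begin
        (λ i → r * v i + - 1# * v′ i) · y
          ≈⟨ ·-linear r (- 1#) v v′ y ⟩
        r * (v · y) + - 1# * (v′ · y)
          ≤⟨ +-cancelˡ-≤ (v′ · z) (begin
               v′ · z + (r * (v · y) + - 1# * (v′ · y))
                 ≈⟨ solve 4 (λ a b c d → a :+ (b :+ d :* c) := (a :+ d :* c) :+ b)
                      refl (v′ · z) (r * (v · y)) (v′ · y) (- 1#) ⟩
               v′ · z + - 1# * (v′ · y) + r * (v · y)
                 ≈⟨ +-congʳ (+-congˡ (neg (v′ · y))) ⟩
               v′ · z - v′ · y + r * (v · y)
                 ≤⟨ +-mono-≤ (large r M≤r) ≤-refl ⟩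
               r * (v · z - v · y) + r * (v · y)
                 ≈⟨ +-comm _ _ ⟩
               r * (v · y) + r * (v · z - v · y)
                 ≈⟨ distribˡ r (v · y) (v · z - v · y) ⟨
               r * (v · y + (v · z - v · y))
                 ≈⟨ *-congˡ (x+[y-x]≈y (v · y) (v · z)) ⟩
               r * (v · z)
                 ≈⟨ x+[y-x]≈y (v′ · z) (r * (v · z)) ⟨
               v′ · z + (r * (v · z) - v′ · z)
                 ≈⟨ +-congˡ (+-congˡ (neg (v′ · z))) ⟨
               v′ · z + (r * (v · z) + - 1# * (v′ · z)) ∎) ⟩
        r * (v · z) + - 1# * (v′ · z)
          ≈⟨ ·-linear r (- 1#) v v′ z ⟨
        (λ i → r * v i + - 1# * v′ i) · z ∎
        where
        neg : ∀ x → - 1# * x ≈ - x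
        neg = -1*x≈-x

      -- Only the toggles and swaps have to be beaten, a finite family, so one threshold serves for
      -- all; `r` is that threshold itself.
      all-beaten = for-large-× (for-large-∀ λ i → beats (toggle-parking i))
                               (for-large-∀ λ i → for-large-∀ λ j → beats (swap-parking i j))
      r = proj₁ all-beaten
      0≤r = proj₁ (proj₂ all-beaten)
      large = proj₂ (proj₂ all-beaten)

  -- The last hypothesis rearranges to `r * (w · x) + w′ · z ≤ r * (w · z) + w′ · x`, and `w · z ≤ w
  -- · x` bounds the right side by `r * (w · x) + w′ · x`.
  minuend-bound : ∀ {r} {w w′ x z : Vector Carrier n} → 0# ≤ r → w · z ≤ w · x →
    (λ i → r * w i + - 1# * w′ i) · x ≤ (λ i → r * w i + - 1# * w′ i) · z →
    w′ · z ≤ w′ · x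
  minuend-bound {r = r} {w} {w′} {x} {z} 0≤r wz≤wx le = +-cancelˡ-≤ (r * (w · x)) (begin
    r * (w · x) + w′ · z
      -- The solver treats `- 1#` as an unknown, so the cancelling pair for `w′ · x` is inserted by
      -- hand.
      ≈⟨ x≈-y+[y+x] (w′ · x) _ ⟩
    - 1# * (w′ · x) + (w′ · x + (r * (w · x) + w′ · z))
      ≈⟨ solve 4 (λ a b c d → d :* b :+ (b :+ (a :+ c)) := (a :+ d :* b) :+ (b :+ c))
           refl (r * (w · x)) (w′ · x) (w′ · z) (- 1#) ⟩
    r * (w · x) + - 1# * (w′ · x) + (w′ · x + w′ · z)
      ≈⟨ +-congʳ (·-linear r (- 1#) w w′ x) ⟨
    (λ i → r * w i + - 1# * w′ i) · x + (w′ · x + w′ · z)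
      ≤⟨ +-mono-≤ le ≤-refl ⟩
    (λ i → r * w i + - 1# * w′ i) · z + (w′ · x + w′ · z)
      ≈⟨ +-congʳ (·-linear r (- 1#) w w′ z) ⟩
    r * (w · z) + - 1# * (w′ · z) + (w′ · x + w′ · z)
      ≈⟨ solve 4 (λ a b c d → (a :+ d :* c) :+ (b :+ c) := d :* c :+ (c :+ (a :+ b)))
           refl (r * (w · z)) (w′ · x) (w′ · z) (- 1#) ⟩
    - 1# * (w′ · z) + (w′ · z + (r * (w · z) + w′ · x))
      ≈⟨ x≈-y+[y+x] (w′ · z) _ ⟨
    r * (w · z) + w′ · x
      ≤⟨ +-mono-≤ (*-monoˡ-≤ 0≤r wz≤wx) ≤-refl ⟩
    r * (w · x) + w′ · x ∎)
    where
    x≈-y+[y+x] : ∀ y x → x ≈ - 1# * y + (y + x)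
    x≈-y+[y+x] y x = begin-equality
      x                    ≈⟨ +-identityˡ x ⟨
      0# + x               ≈⟨ +-congʳ (-‿inverseˡ y) ⟨
      - y + y + x          ≈⟨ +-assoc (- y) y x ⟩
      - y + (y + x)        ≈⟨ +-congʳ (-1*x≈-x y) ⟨
      - 1# * y + (y + x)   ∎

  -- Choosing top uniformly in u is what transfers cones from one polytope to another.
  record MaximalVertex (w : Vector Carrier n) : Set₁ where
    field
      top         : Vector Carrier n → Vector Carrier n
      Cone        : Vector Carrier n → Set
      w∈Cone      : Cone w
      top-parking : ∀ {u} → Nonnegative u → Nondecreasing u → IsParking u (top u)
      top-maximal : ∀ {f u a} → Cone f → IsParking u a → f · a ≤ f · top u
      absorb-top  : ∀ {e w′} → StrictlyIncreasing e →
        (∀ {y} → IsParking e y → w′ · y ≤ w′ · top e) →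
        (∀ {y} → IsParking e y → w · y ≈ w · top e → w′ · top e ≤ w′ · y) →
        Cone w′ × ∃[ r ] 0# ≤ r × Cone (λ i → r * w i + - 1# * w′ i)

    -- `absorb-top` puts `r w - w′` into `Cone`, so its value at `x` is at most that at `top u`, and
    -- `minuend-bound` applies. The point `x` enters only through such bounds, so it may be any
    -- point of the polytope and not just a vertex.
    face-inclusion : ∀ {e w′ u x} → StrictlyIncreasing e →
      (∀ {y} → IsParking e y → w′ · y ≤ w′ · top e) →
      (∀ {y} → IsParking e y → w · y ≈ w · top e → w′ · top e ≤ w′ · y) →
      (∀ {f} → Cone f → f · x ≤ f · top u) → w · top u ≤ w · x →
      Cone w′ × w′ · top u ≤ w′ · x
    face-inclusion {e} {w′} {u} {x} e-strict w′-maximal w′-constant x-bound top≤x =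
      let w′∈Cone , r , 0≤r , difference∈Cone =
            absorb-top {e} {w′} e-strict w′-maximal w′-constant
      in w′∈Cone , minuend-bound {r = r} {w} {w′} {x} {top u} 0≤r top≤x
           (x-bound {λ i → r * w i + - 1# * w′ i} difference∈Cone)

  -- Everything is pulled back along the permutation `π` that sorts `w`. Both `π` and `S` depend on
  -- `w` alone, which makes the choice of `top` uniform in `u`.
  maximalVertex : ∀ (w : Vector Carrier n) → MaximalVertex w
  maximalVertex {n} w = record
    { top         = top
    ; Cone        = λ f → Compatible S (f ∘ (π ⟨$⟩ʳ_))
    ; w∈Cone      = compatible
    ; top-parking = λ {u} 0≤u u-mono →
        parking-permute (Perm.flip π) (truncate-parking 0≤u u-mono S)
    ; top-maximal = λ {f} {u} {a} f-compatible parking → begin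
        f · a                                ≈⟨ ·-permute f a π ⟩
        (f ∘ (π ⟨$⟩ʳ_)) · (a ∘ (π ⟨$⟩ʳ_))    ≤⟨ compatible⇒maximal up f-compatible (parking-permute π parking) ⟩
        (f ∘ (π ⟨$⟩ʳ_)) · truncate u S       ≈⟨ ·-top f u ⟨
        f · top u                            ∎
    ; absorb-top  = λ {e} {w′} e-strict w′-maximal w′-constant →
        absorb e-strict up {w ∘ (π ⟨$⟩ʳ_)} {w′ ∘ (π ⟨$⟩ʳ_)} compatible
          (λ {y} y-parking → begin
            (w′ ∘ (π ⟨$⟩ʳ_)) · y               ≈⟨ ·-permuteˡ w′ y π ⟨
            w′ · (y ∘ (π ⟨$⟩ˡ_))               ≤⟨ w′-maximal (parking-permute (Perm.flip π) y-parking) ⟩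
            w′ · top e                         ≈⟨ ·-top w′ e ⟩
            (w′ ∘ (π ⟨$⟩ʳ_)) · truncate e S    ∎)
          (λ {y} y-parking vy≈vz → begin
            (w′ ∘ (π ⟨$⟩ʳ_)) · truncate e S    ≈⟨ ·-top w′ e ⟨
            w′ · top e                         ≤⟨ w′-constant (parking-permute (Perm.flip π) y-parking)
                                                    (trans (·-permuteˡ w y π) (trans vy≈vz (sym (·-top w e)))) ⟩
            w′ · (y ∘ (π ⟨$⟩ˡ_))               ≈⟨ ·-permuteˡ w′ y π ⟩
            (w′ ∘ (π ⟨$⟩ʳ_)) · y               ∎)
    }
    where
    sorting = sort w
    π = proj₁ sorting
    signs = compatible-sign (w ∘ (π ⟨$⟩ʳ_)) (proj₁ (proj₂ sorting))
    S = proj₁ signs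
    up : UpClosed S
    up = proj₁ (proj₂ signs)
    compatible : Compatible S (w ∘ (π ⟨$⟩ʳ_))
    compatible = proj₂ (proj₂ signs)
    top : Vector Carrier n → Vector Carrier n
    top u = truncate u S ∘ (π ⟨$⟩ˡ_)
    ·-top : ∀ f u → f · top u ≈ (f ∘ (π ⟨$⟩ʳ_)) · truncate u S
    ·-top f u = ·-permuteˡ f (truncate u S) π

open import Defs
open import Axiom.ExcludedMiddle using (ExcludedMiddle)
open ℚSolver.+-*-Solver using (solve; con; _:=_; _:+_; _:*_; _:-_; :-_)

-- Rational and real numbers.  Since _≤_ and _≈_ do not determine the reals they
-- compare, these are mostly given explicitly.

private
  ℚ-diff : ∀ {p q} → p ℚ.< q → 0ℚ ℚ.< q ℚ.- p
  ℚ-diff {p} {q} p<q = subst (ℚ._< q ℚ.- p) (ℚₚ.+-inverseʳ p) (ℚₚ.+-monoˡ-< (ℚ.- p) p<q)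

  <-from-diff : ∀ {p q} d → 0ℚ ℚ.< d → q ≡ p ℚ.+ d → p ℚ.< q
  <-from-diff {p} d 0<d ≡.refl = subst (ℚ._< p ℚ.+ d) (ℚₚ.+-identityʳ p) (ℚₚ.+-monoʳ-< p 0<d)

  ℚ-+-pos : ∀ {p q} → 0ℚ ℚ.< p → 0ℚ ℚ.< q → 0ℚ ℚ.< p ℚ.+ q
  ℚ-+-pos = ℚₚ.+-mono-<

  ℚ-*-pos : ∀ {p q} → 0ℚ ℚ.< p → 0ℚ ℚ.< q → 0ℚ ℚ.< p ℚ.* q
  ℚ-*-pos {p} {q} 0<p 0<q =
    ℚₚ.positive⁻¹ (p ℚ.* q) {{ℚₚ.pos*pos⇒pos p {{ℚ.positive 0<p}} q {{ℚ.positive 0<q}}}}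

  ℚ-half : ∀ {ε} → 0ℚ ℚ.< ε → ∃[ δ ] 0ℚ ℚ.< δ × ε ≡ δ ℚ.+ δ
  ℚ-half {ε} 0<ε = ½ ℚ.* ε , ℚ-*-pos (ℚₚ.positive⁻¹ ½) 0<ε ,
    solve 1 (λ e → e := con ½ :* e :+ con ½ :* e) ≡.refl ε

  ℚ-divide : ∀ {p q} → 0ℚ ℚ.< p → 0ℚ ℚ.< q → ∃[ r ] 0ℚ ℚ.< r × p ℚ.* r ≡ q
  ℚ-divide {p} {q} 0<p 0<q = p⁻¹ ℚ.* q , ℚ-*-pos (ℚₚ.positive⁻¹ p⁻¹ {{ℚₚ.1/pos⇒pos p}}) 0<q ,
    ≡.trans (≡.sym (ℚₚ.*-assoc p p⁻¹ q))
            (≡.trans (≡.cong (ℚ._* q) (ℚₚ.*-inverseʳ p)) (ℚₚ.*-identityˡ q))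
    where
    instance
      p-pos = ℚ.positive 0<p
      p-nonZero = ℚₚ.pos⇒nonZero p
    p⁻¹ = ℚ.1/ p

  p≤∣p∣ : ∀ p → p ℚ.≤ ℚ.∣ p ∣
  p≤∣p∣ p with ℚₚ.≤-total 0ℚ p
  ... | inj₁ 0≤p = ℚₚ.≤-reflexive (≡.sym (ℚₚ.0≤p⇒∣p∣≡p 0≤p))
  ... | inj₂ p≤0 = ℚₚ.≤-trans p≤0 (ℚₚ.0≤∣p∣ p)

  -p≤∣p∣ : ∀ p → ℚ.- p ℚ.≤ ℚ.∣ p ∣
  -p≤∣p∣ p = subst (ℚ.- p ℚ.≤_) (ℚₚ.∣-p∣≡∣p∣ p) (p≤∣p∣ (ℚ.- p))

  ∣-∣<⇒< : ∀ {p q ε} → ℚ.∣ p ℚ.- q ∣ ℚ.< ε → p ℚ.< q ℚ.+ ε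
  ∣-∣<⇒< {p} {q} {ε} lt = <-from-diff _ (ℚ-diff (ℚₚ.≤-<-trans (p≤∣p∣ (p ℚ.- q)) lt))
    (solve 3 (λ p q e → q :+ e := p :+ (e :- (p :- q))) ≡.refl p q ε)

  ∣-∣<⇒>  : ∀ {p q ε} → ℚ.∣ p ℚ.- q ∣ ℚ.< ε → q ℚ.< p ℚ.+ ε
  ∣-∣<⇒> {p} {q} {ε} lt = <-from-diff _ (ℚ-diff (ℚₚ.≤-<-trans (-p≤∣p∣ (p ℚ.- q)) lt))
    (solve 3 (λ p q e → p :+ e := q :+ (e :- (:- (p :- q)))) ≡.refl p q ε)

  <×>⇒∣-∣< : ∀ {p q ε} → p ℚ.< q ℚ.+ ε → q ℚ.< p ℚ.+ ε → ℚ.∣ p ℚ.- q ∣ ℚ.< ε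
  <×>⇒∣-∣< {p} {q} {ε} p< q< with ℚₚ.∣p∣≡p∨∣p∣≡-p (p ℚ.- q)
  ... | inj₁ eq = subst (ℚ._< ε) (≡.sym eq) (<-from-diff _ (ℚ-diff p<)
    (solve 3 (λ p q e → e := (p :- q) :+ ((q :+ e) :- p)) ≡.refl p q ε))
  ... | inj₂ eq = subst (ℚ._< ε) (≡.sym eq) (<-from-diff _ (ℚ-diff q<)
    (solve 3 (λ p q e → e := (:- (p :- q)) :+ ((p :+ e) :- q)) ≡.refl p q ε))

  -- Limits, order and equality of real numbers

  Eventually : (ℕ → Set) → Set
  Eventually P = ∃[ N ] ∀ n → N ℕ.≤ n → P n

  always : ∀ {P : ℕ → Set} → (∀ n → P n) → Eventually P
  always p = 0 , λ n _ → p n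

  eventually-map : ∀ {P Q : ℕ → Set} → (∀ n → P n → Q n) → Eventually P → Eventually Q
  eventually-map f (N , p) = N , λ n N≤n → f n (p n N≤n)

  eventually-map₂ : ∀ {P Q R : ℕ → Set} → (∀ n → P n → Q n → R n) →
    Eventually P → Eventually Q → Eventually R
  eventually-map₂ f (M , p) (N , q) = M ℕ.⊔ N , λ n ≤n →
    f n (p n (ℕₚ.m⊔n≤o⇒m≤o M N ≤n)) (q n (ℕₚ.m⊔n≤o⇒n≤o M N ≤n))

-- The ring operations act termwise, so the ring laws reduce through this to those of the rationals.
pointwise-≈ : ∀ {x y} → (∀ n → seq x n ≡ seq y n) → x ≈ y
pointwise-≈ {x} {y} eq ε 0<ε = always λ n → subst (ℚ._< ε)
  (≡.cong ℚ.∣_∣ (≡.sym (≡.trans (≡.cong (ℚ._- seq y n) (eq n)) (ℚₚ.+-inverseʳ (seq y n))))) 0<ε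

≈⇒≤ : ∀ {x y} → x ≈ y → x ≤ y
≈⇒≤ {x} x≈y ε 0<ε = eventually-map (λ n → ∣-∣<⇒< {seq x n}) (x≈y ε 0<ε)

≈-sym : ∀ {x y} → x ≈ y → y ≈ x
≈-sym {x} {y} x≈y ε 0<ε = eventually-map
  (λ n lt → <×>⇒∣-∣< {seq y n} (∣-∣<⇒> {seq x n} lt) (∣-∣<⇒< {seq x n} lt)) (x≈y ε 0<ε)

≤-antisym : ∀ {x y} → x ≤ y → y ≤ x → x ≈ y
≤-antisym {x} x≤y y≤x ε 0<ε =
  eventually-map₂ (λ n → <×>⇒∣-∣< {seq x n}) (x≤y ε 0<ε) (y≤x ε 0<ε)

private
  trans-slack : ∀ {x y z δ} → x ℚ.< y ℚ.+ δ → y ℚ.< z ℚ.+ δ → x ℚ.< z ℚ.+ (δ ℚ.+ δ)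
  trans-slack {x} {y} {z} {δ} p q = ℚₚ.<-trans p
    (subst (y ℚ.+ δ ℚ.<_) (ℚₚ.+-assoc z δ δ) (ℚₚ.+-monoˡ-< δ q))

  +-slack : ∀ {x y z t δ} → x ℚ.< y ℚ.+ δ → z ℚ.< t ℚ.+ δ → x ℚ.+ z ℚ.< y ℚ.+ t ℚ.+ (δ ℚ.+ δ)
  +-slack {x} {y} {z} {t} {δ} p q = subst (x ℚ.+ z ℚ.<_)
    (solve 3 (λ y t d → y :+ d :+ (t :+ d) := y :+ t :+ (d :+ d)) ≡.refl y t δ)
    (ℚₚ.+-mono-< p q)

≤-trans : ∀ {x y z} → x ≤ y → y ≤ z → x ≤ z
≤-trans {x} {y} {z} x≤y y≤z ε 0<ε =
  let δ , 0<δ , ε≡δ+δ = ℚ-half 0<ε in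
  eventually-map₂
    (λ n p q → subst (λ ε → seq x n ℚ.< seq z n ℚ.+ ε) (≡.sym ε≡δ+δ)
      (trans-slack {seq x n} {seq y n} {seq z n} p q))
    (x≤y δ 0<δ) (y≤z δ 0<δ)

+-mono-≤ : ∀ {x y z t} → x ≤ y → z ≤ t → x + z ≤ y + t
+-mono-≤ {x} {y} {z} {t} x≤y z≤t ε 0<ε =
  let δ , 0<δ , ε≡δ+δ = ℚ-half 0<ε in
  eventually-map₂
    (λ n p q → subst (λ ε → seq x n ℚ.+ seq z n ℚ.< seq y n ℚ.+ seq t n ℚ.+ ε) (≡.sym ε≡δ+δ)
      (+-slack {seq x n} {seq y n} {seq z n} {seq t n} p q))
    (x≤y δ 0<δ) (z≤t δ 0<δ)

≈-trans : ∀ {x y z} → x ≈ y → y ≈ z → x ≈ z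
≈-trans {x} {y} {z} x≈y y≈z = ≤-antisym {x} {z}
  (≤-trans {x} {y} {z} (≈⇒≤ {x} {y} x≈y) (≈⇒≤ {y} {z} y≈z))
  (≤-trans {z} {y} {x} (≈⇒≤ {z} {y} (≈-sym {y} {z} y≈z)) (≈⇒≤ {y} {x} (≈-sym {x} {y} x≈y)))

+-cong : ∀ {x y z t} → x ≈ y → z ≈ t → x + z ≈ y + t
+-cong {x} {y} {z} {t} x≈y z≈t = ≤-antisym {x + z} {y + t}
  (+-mono-≤ {x} {y} {z} {t} (≈⇒≤ {x} {y} x≈y) (≈⇒≤ {z} {t} z≈t))
  (+-mono-≤ {y} {x} {t} {z} (≈⇒≤ {y} {x} (≈-sym {x} {y} x≈y)) (≈⇒≤ {t} {z} (≈-sym {z} {t} z≈t)))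

-- Products and the ring structure of the reals

private
  small : ∀ {ε} → 0ℚ ℚ.< ε → ∃[ δ ] 0ℚ ℚ.< δ × δ ℚ.≤ ε × δ ℚ.≤ 1ℚ
  small {ε} 0<ε with ℚₚ.≤-total ε 1ℚ
  ... | inj₁ ε≤1 = ε , 0<ε , ℚₚ.≤-refl , ε≤1
  ... | inj₂ 1≤ε = 1ℚ , ℚₚ.positive⁻¹ 1ℚ , 1≤ε , ℚₚ.≤-refl

eventually-bounded : ∀ x → ∃[ B ] 0ℚ ℚ.< B × Eventually λ n → ℚ.∣ seq x n ∣ ℚ.< B
eventually-bounded x with cauchy x 1ℚ (ℚₚ.positive⁻¹ 1ℚ)
... | N , close = 1ℚ ℚ.+ ℚ.∣ seq x N ∣ ,
  ℚₚ.+-mono-<-≤ (ℚₚ.positive⁻¹ 1ℚ) (ℚₚ.0≤∣p∣ (seq x N)) , N , λ n N≤n → begin-strict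
    ℚ.∣ seq x n ∣
      ≡⟨ ≡.cong ℚ.∣_∣ (solve 2 (λ a b → a := (a :- b) :+ b) ≡.refl (seq x n) (seq x N)) ⟩
    ℚ.∣ (seq x n ℚ.- seq x N) ℚ.+ seq x N ∣
      ≤⟨ ℚₚ.∣p+q∣≤∣p∣+∣q∣ (seq x n ℚ.- seq x N) (seq x N) ⟩
    ℚ.∣ seq x n ℚ.- seq x N ∣ ℚ.+ ℚ.∣ seq x N ∣
      <⟨ ℚₚ.+-monoˡ-< ℚ.∣ seq x N ∣ (close n N N≤n ℕₚ.≤-refl) ⟩
    1ℚ ℚ.+ ℚ.∣ seq x N ∣ ∎
  where open ℚₚ.≤-Reasoning

private
  -- Expanding 0 < (a + η) (b + η).
  product-bound : ∀ a b A B η → 0ℚ ℚ.< η → η ℚ.< 1ℚ → a ℚ.< A → b ℚ.< B →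
    0ℚ ℚ.< a ℚ.+ η → 0ℚ ℚ.< b ℚ.+ η → 0ℚ ℚ.< a ℚ.* b ℚ.+ (A ℚ.+ B ℚ.+ 1ℚ) ℚ.* η
  product-bound a b A B η 0<η η<1 a<A b<B 0<a+η 0<b+η = subst (0ℚ ℚ.<_) (≡.sym expand)
    (ℚ-+-pos (ℚ-*-pos 0<a+η 0<b+η)
      (ℚ-*-pos 0<η (ℚ-+-pos (ℚ-+-pos (ℚ-diff a<A) (ℚ-diff b<B)) (ℚ-diff η<1))))
    where
    expand : a ℚ.* b ℚ.+ (A ℚ.+ B ℚ.+ 1ℚ) ℚ.* η ≡
      (a ℚ.+ η) ℚ.* (b ℚ.+ η) ℚ.+ η ℚ.* (A ℚ.- a ℚ.+ (B ℚ.- b) ℚ.+ (1ℚ ℚ.- η))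
    expand = solve 6 (λ a b A B η one →
        a :* b :+ (A :+ B :+ one) :* η :=
        (a :+ η) :* (b :+ η) :+ η :* (A :- a :+ (B :- b) :+ (one :- η)))
      ≡.refl a b A B η 1ℚ

  -- `η` is the smaller of `ε` and one, divided by `K`; dividing by `K > 1` makes it strictly less
  -- than one.
  choose-η : ∀ {K ε} → 1ℚ ℚ.< K → 0ℚ ℚ.< ε → ∃[ η ] 0ℚ ℚ.< η × η ℚ.< 1ℚ × K ℚ.* η ℚ.≤ ε
  choose-η {K} {ε} 1<K 0<ε =
    let δ , 0<δ , δ≤ε , δ≤1 = small 0<ε
        η , 0<η , Kη≡δ = ℚ-divide (ℚₚ.<-trans (ℚₚ.positive⁻¹ 1ℚ) 1<K) 0<δ
        η<Kη = subst (ℚ._< K ℚ.* η) (ℚₚ.*-identityˡ η)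
                 (ℚₚ.*-monoˡ-<-pos η {{ℚ.positive 0<η}} 1<K)
    in η , 0<η , ℚₚ.<-≤-trans (subst (η ℚ.<_) Kη≡δ η<Kη) δ≤1 ,
       subst (ℚ._≤ ε) (≡.sym Kη≡δ) δ≤ε

-- Both factors eventually exceed `-η` and are bounded by `A` and `B`, so their product exceeds
-- `-(A + B + 1) η`; `η` is chosen to make that at least `-ε`.
*-nonneg : ∀ {x y} → 0ℝ ≤ x → 0ℝ ≤ y → 0ℝ ≤ x * y
*-nonneg {x} {y} 0≤x 0≤y ε 0<ε =
  let A , 0<A , ∣x∣<A = eventually-bounded x
      B , 0<B , ∣y∣<B = eventually-bounded y
      η , 0<η , η<1 , Kη≤ε = choose-η {A ℚ.+ B ℚ.+ 1ℚ} (ℚₚ.+-monoˡ-< 1ℚ (ℚ-+-pos 0<A 0<B)) 0<ε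
  in eventually-map₂
    (λ n (0<x+η , x<A) (0<y+η , y<B) → ℚₚ.<-≤-trans
      (product-bound (seq x n) (seq y n) A B η 0<η η<1
        (ℚₚ.≤-<-trans (p≤∣p∣ (seq x n)) x<A) (ℚₚ.≤-<-trans (p≤∣p∣ (seq y n)) y<B) 0<x+η 0<y+η)
      (ℚₚ.+-monoʳ-≤ (seq x n ℚ.* seq y n) Kη≤ε))
    (eventually-map₂ (λ _ → _,_) (0≤x η 0<η) ∣x∣<A)
    (eventually-map₂ (λ _ → _,_) (0≤y η 0<η) ∣y∣<B)

private
  product-small : ∀ x y z {B δ} → 0ℚ ℚ.< δ → ℚ.∣ x ∣ ℚ.< B → ℚ.∣ y ℚ.- z ∣ ℚ.< δ →
    ℚ.∣ x ℚ.* y ℚ.- x ℚ.* z ∣ ℚ.< B ℚ.* δ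
  product-small x y z {B} {δ} 0<δ x<B y-z<δ = begin-strict
    ℚ.∣ x ℚ.* y ℚ.- x ℚ.* z ∣
      ≡⟨ ≡.cong ℚ.∣_∣ (solve 3 (λ x y z → x :* y :- x :* z := x :* (y :- z)) ≡.refl x y z) ⟩
    ℚ.∣ x ℚ.* (y ℚ.- z) ∣        ≡⟨ ℚₚ.∣p*q∣≡∣p∣*∣q∣ x (y ℚ.- z) ⟩
    ℚ.∣ x ∣ ℚ.* ℚ.∣ y ℚ.- z ∣    ≤⟨ ℚₚ.*-monoˡ-≤-nonNeg ℚ.∣ x ∣ {{ℚₚ.∣-∣-nonNeg x}} (ℚₚ.<⇒≤ y-z<δ) ⟩
    ℚ.∣ x ∣ ℚ.* δ                <⟨ ℚₚ.*-monoˡ-<-pos δ {{ℚ.positive 0<δ}} x<B ⟩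
    B ℚ.* δ                      ∎
    where open ℚₚ.≤-Reasoning

*-congˡ : ∀ {x y z} → y ≈ z → x * y ≈ x * z
*-congˡ {x} {y} {z} y≈z ε 0<ε =
  let B , 0<B , ∣x∣<B = eventually-bounded x
      δ , 0<δ , Bδ≡ε = ℚ-divide 0<B 0<ε
  in eventually-map₂
    (λ n x<B y-z<δ → subst (ℚ.∣ seq x n ℚ.* seq y n ℚ.- seq x n ℚ.* seq z n ∣ ℚ.<_) Bδ≡ε
      (product-small (seq x n) (seq y n) (seq z n) 0<δ x<B y-z<δ))
    ∣x∣<B (y≈z δ 0<δ)

*-cong : ∀ {x y z t} → x ≈ y → z ≈ t → x * z ≈ y * t
*-cong {x} {y} {z} {t} x≈y z≈t = ≈-trans {x * z} {x * t} {y * t} (*-congˡ {x} {z} {t} z≈t)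
  (≈-trans {x * t} {t * x} {y * t} (comm x t)
    (≈-trans {t * x} {t * y} {y * t} (*-congˡ {t} {x} {y} x≈y) (comm t y)))
  where
  comm : ∀ a b → a * b ≈ b * a
  comm a b = pointwise-≈ {a * b} {b * a} λ n → ℚₚ.*-comm (seq a n) (seq b n)

-- As a product with a constant, negation inherits its Cauchy proof from `_*_` and its congruence
-- from `*-congˡ`.
-_ : ℝ → ℝ
- x = fromℚ (ℚ.- 1ℚ) * x

private
  -1*p+p≡0 : ∀ p → ℚ.- 1ℚ ℚ.* p ℚ.+ p ≡ 0ℚ
  -1*p+p≡0 = solve 1 (λ p → con (ℚ.- 1ℚ) :* p :+ p := con 0ℚ) ≡.refl

ℝ-commutativeRing : CommutativeRing 0ℓ 0ℓ
ℝ-commutativeRing = record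
  { Carrier = ℝ
  ; _≈_ = _≈_
  ; _+_ = _+_
  ; _*_ = _*_
  ; -_ = -_
  ; 0# = 0ℝ
  ; 1# = 1ℝ
  ; isCommutativeRing = record
    { isRing = record
      { +-isAbelianGroup = record
        { isGroup = record
          { isMonoid = record
            { isSemigroup = record
              { isMagma = record
                { isEquivalence = record
                  { refl = λ {x} → pointwise-≈ {x} {x} λ _ → ≡.refl
                  ; sym = λ {x} {y} → ≈-sym {x} {y}
                  ; trans = λ {x} {y} {z} → ≈-trans {x} {y} {z}
                  }
                ; ∙-cong = λ {x} {y} {z} {t} → +-cong {x} {y} {z} {t}
                }
              ; assoc = λ x y z → pointwise-≈ {x + y + z} {x + (y + z)} λ n →
                  ℚₚ.+-assoc (seq x n) (seq y n) (seq z n)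
              }
            ; identity = (λ x → pointwise-≈ {0ℝ + x} {x} λ n → ℚₚ.+-identityˡ (seq x n)) ,
                         (λ x → pointwise-≈ {x + 0ℝ} {x} λ n → ℚₚ.+-identityʳ (seq x n))
            }
          ; inverse = (λ x → pointwise-≈ {(- x) + x} {0ℝ} λ n → -1*p+p≡0 (seq x n)) ,
                      (λ x → pointwise-≈ {x + (- x)} {0ℝ} λ n →
                        ≡.trans (ℚₚ.+-comm (seq x n) _) (-1*p+p≡0 (seq x n)))
          ; ⁻¹-cong = λ {x} {y} → *-congˡ {fromℚ (ℚ.- 1ℚ)} {x} {y}
          }
        ; comm = λ x y → pointwise-≈ {x + y} {y + x} λ n → ℚₚ.+-comm (seq x n) (seq y n)
        }
      ; *-cong = λ {x} {y} {z} {t} → *-cong {x} {y} {z} {t}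
      ; *-assoc = λ x y z → pointwise-≈ {x * y * z} {x * (y * z)} λ n →
          ℚₚ.*-assoc (seq x n) (seq y n) (seq z n)
      ; *-identity = (λ x → pointwise-≈ {1ℝ * x} {x} λ n → ℚₚ.*-identityˡ (seq x n)) ,
                     (λ x → pointwise-≈ {x * 1ℝ} {x} λ n → ℚₚ.*-identityʳ (seq x n))
      ; distrib = (λ x y z → pointwise-≈ {x * (y + z)} {x * y + x * z} λ n →
                    ℚₚ.*-distribˡ-+ (seq x n) (seq y n) (seq z n)) ,
                  (λ x y z → pointwise-≈ {(y + z) * x} {y * x + z * x} λ n →
                    ℚₚ.*-distribʳ-+ (seq x n) (seq y n) (seq z n))
      }
    ; *-comm = λ x y → pointwise-≈ {x * y} {y * x} λ n → ℚₚ.*-comm (seq x n) (seq y n)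
    }
  }

fromℚ-mono-≤ : ∀ {p q} → p ℚ.≤ q → fromℚ p ≤ fromℚ q
fromℚ-mono-≤ p≤q ε 0<ε = always λ _ → ℚₚ.≤-<-trans p≤q (<-from-diff ε 0<ε ≡.refl)

fromℚ-positive : ∀ {q} → 0ℚ ℚ.< q → ¬ fromℚ q ≤ 0ℝ
fromℚ-positive {q} 0<q q≤0 with q≤0 q 0<q
... | N , q<0+q = ℚₚ.<-irrefl (≡.sym (ℚₚ.+-identityˡ q)) (q<0+q N ℕₚ.≤-refl)

-- The total order on the reals under excluded middle

module ClassicalReals (em : ExcludedMiddle 0ℓ) where

  private

    stays-below : ∀ {x y X Y δ} → ℚ.∣ x ℚ.- X ∣ ℚ.< δ → ℚ.∣ y ℚ.- Y ∣ ℚ.< δ →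
      X ℚ.≤ Y ℚ.+ (δ ℚ.+ δ) → x ℚ.< y ℚ.+ (δ ℚ.+ δ ℚ.+ (δ ℚ.+ δ))
    stays-below {x} {y} {X} {Y} {δ} x~X y~Y X≤ = begin-strict
      x                                  <⟨ ∣-∣<⇒< {x} x~X ⟩
      X ℚ.+ δ                            ≤⟨ ℚₚ.+-monoˡ-≤ δ X≤ ⟩
      Y ℚ.+ (δ ℚ.+ δ) ℚ.+ δ              <⟨ ℚₚ.+-monoˡ-< δ (ℚₚ.+-monoˡ-< (δ ℚ.+ δ) (∣-∣<⇒> {y} y~Y)) ⟩
      y ℚ.+ δ ℚ.+ (δ ℚ.+ δ) ℚ.+ δ        ≡⟨ solve 2 (λ y δ → y :+ δ :+ (δ :+ δ) :+ δ :=
                                              y :+ (δ :+ δ :+ (δ :+ δ))) ≡.refl y δ ⟩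
      y ℚ.+ (δ ℚ.+ δ ℚ.+ (δ ℚ.+ δ))      ∎
      where open ℚₚ.≤-Reasoning

    stays-above : ∀ {x y X Y δ} → ℚ.∣ x ℚ.- X ∣ ℚ.< δ → ℚ.∣ y ℚ.- Y ∣ ℚ.< δ →
      y ℚ.+ (X ℚ.- (Y ℚ.+ (δ ℚ.+ δ))) ℚ.< x
    stays-above {x} {y} {X} {Y} {δ} x~X y~Y = <-from-diff _
      (ℚ-+-pos (ℚ-diff (∣-∣<⇒> {x} x~X)) (ℚ-diff (∣-∣<⇒< {y} y~Y)))
      (solve 5 (λ x y X Y δ →
        x := y :+ (X :- (Y :+ (δ :+ δ))) :+ (((x :+ δ) :- X) :+ ((Y :+ δ) :- y)))
        ≡.refl x y X Y δ)

  private
    Apart : ℝ → ℝ → Set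
    Apart x y = ∃[ δ ] 0ℚ ℚ.< δ × Eventually λ n → seq y n ℚ.+ δ ℚ.< seq x n

    -- One rational comparison at `K`, with margin `2δ`, settles the tail: the two sequences
    -- together drift by less than `2δ`, which leaves either the bound with slack `4δ` or a uniform
    -- positive gap.
    compare-up-to : ∀ x y δ K →
      (∀ n → K ℕ.≤ n → ℚ.∣ seq x n ℚ.- seq x K ∣ ℚ.< δ) →
      (∀ n → K ℕ.≤ n → ℚ.∣ seq y n ℚ.- seq y K ∣ ℚ.< δ) →
      (Eventually λ n → seq x n ℚ.< seq y n ℚ.+ (δ ℚ.+ δ ℚ.+ (δ ℚ.+ δ))) ⊎ Apart x y
    compare-up-to x y δ K x~ y~ = decide (seq x K ℚₚ.≤? seq y K ℚ.+ (δ ℚ.+ δ))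
      where
      decide : Dec (seq x K ℚ.≤ seq y K ℚ.+ (δ ℚ.+ δ)) → _
      decide (yes X≤) = inj₁ (K , λ n K≤n → stays-below {seq x n} {seq y n} (x~ n K≤n) (y~ n K≤n) X≤)
      decide (no X≰) = inj₂ (_ , ℚ-diff (ℚₚ.≰⇒> X≰) , K , λ n K≤n →
        stays-above {seq x n} {seq y n} (x~ n K≤n) (y~ n K≤n))

    ¬apart⇒≤ : ∀ x y → ¬ Apart x y → x ≤ y
    ¬apart⇒≤ x y ¬apart ε 0<ε =
      -- Halving twice gives `ε = 4δ`, the slack in `compare-up-to`.
      let γ , 0<γ , ε≡γ+γ = ℚ-half 0<ε
          δ , 0<δ , γ≡δ+δ = ℚ-half 0<γ
          M , x-close = cauchy x δ 0<δ
          N , y-close = cauchy y δ 0<δ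
          K = M ℕ.⊔ N
      in [ eventually-map (λ n → subst (λ ε → seq x n ℚ.< seq y n ℚ.+ ε)
             (≡.sym (≡.trans ε≡γ+γ (≡.cong₂ ℚ._+_ γ≡δ+δ γ≡δ+δ))))
         , (λ apart → contradiction apart ¬apart)
         ]′ (compare-up-to x y δ K
              (λ n K≤n → x-close n K (ℕₚ.m⊔n≤o⇒m≤o M N K≤n) (ℕₚ.m≤m⊔n M N))
              (λ n K≤n → y-close n K (ℕₚ.m⊔n≤o⇒n≤o M N K≤n) (ℕₚ.m≤n⊔m M N)))

    -- Excluded middle turns a refuted inequality into a witness: the uniform rational gap from
    -- which a reciprocal can be formed.
    ≰⇒apart : ∀ {x y} → ¬ x ≤ y → Apart x y
    ≰⇒apart {x} {y} x≰y with em {Apart x y}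
    ... | yes apart = apart
    ... | no ¬apart = contradiction (¬apart⇒≤ x y ¬apart) x≰y

    apart⇒≥ : ∀ {x y} → Apart x y → y ≤ x
    apart⇒≥ (δ , 0<δ , y+δ<x) ε 0<ε = eventually-map
      (λ n lt → ℚₚ.<-trans (<-from-diff δ 0<δ ≡.refl) (ℚₚ.<-trans lt (<-from-diff ε 0<ε ≡.refl))) y+δ<x

    -- The gap `δ` is a rational lower bound for the tail of `x`, so the constant `1 / δ` serves as
    -- `r`.
    apart-zero⇒unbounded : ∀ {x} → Apart x 0ℝ → ∃[ r ] 0ℝ ≤ r × 1ℝ ≤ r * x
    apart-zero⇒unbounded {x} (δ , 0<δ , δ<x) =
      let q , 0<q , δq≡1 = ℚ-divide 0<δ (ℚₚ.positive⁻¹ 1ℚ)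
          q[0+δ]≡1 = ≡.trans (≡.cong (q ℚ.*_) (ℚₚ.+-identityˡ δ)) (≡.trans (ℚₚ.*-comm q δ) δq≡1)
      in fromℚ q , fromℚ-mono-≤ (ℚₚ.<⇒≤ 0<q) , λ ε 0<ε → eventually-map
        (λ n lt → ℚₚ.<-trans
          (subst (ℚ._< q ℚ.* seq x n) q[0+δ]≡1 (ℚₚ.*-monoʳ-<-pos q {{ℚ.positive 0<q}} lt))
          (<-from-diff ε 0<ε ≡.refl))
        δ<x

  ≤-total : ∀ x y → x ≤ y ⊎ y ≤ x
  ≤-total x y with em {x ≤ y}
  ... | yes x≤y = inj₁ x≤y
  ... | no  x≰y = inj₂ (apart⇒≥ {x} {y} (≰⇒apart {x} {y} x≰y))

  ℝ-orderedRing : OrderedRing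
  ℝ-orderedRing = record
    { commutativeRing = ℝ-commutativeRing
    ; _≤_ = _≤_
    ; isDecTotalOrder = record
      { isTotalOrder = record
        { isPartialOrder = record
          { isPreorder = record
            { isEquivalence = CommutativeRing.isEquivalence ℝ-commutativeRing
            ; reflexive = λ {x} {y} → ≈⇒≤ {x} {y}
            ; trans = λ {x} {y} {z} → ≤-trans {x} {y} {z}
            }
          ; antisym = λ {x} {y} → ≤-antisym {x} {y}
          }
        ; total = ≤-total
        }
      ; _≟_ = λ _ _ → em
      ; _≤?_ = λ _ _ → em
      }
    ; +-mono-≤ = λ {x} {y} {z} {t} → +-mono-≤ {x} {y} {z} {t}
    ; *-nonneg = λ {x} {y} → *-nonneg {x} {y}
    ; positive-unbounded = λ {x} x≰0 → apart-zero⇒unbounded {x} (≰⇒apart {x} {0ℝ} x≰0)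
    }

-- Normal cones

-- Normalisation keeps `k / 1` from computing for a variable `k`, so the comparison is made among
-- unnormalised rationals.
ℕ/1-mono-< : ∀ {a b} → a ℕ.< b → (ℤ.+ a) ℚ./ 1 ℚ.< (ℤ.+ b) ℚ./ 1
ℕ/1-mono-< {a} {b} a<b = ℚₚ.toℚᵘ-cancel-< (ℚᵘₚ.<-respˡ-≃ (≃/1 a) (ℚᵘₚ.<-respʳ-≃ (≃/1 b)
  (ℚᵘ.*<* (ℤₚ.*-monoʳ-<-pos (ℤ.+ 1) (ℤ.+<+ a<b)))))
  where
  ≃/1 : ∀ k → ℚᵘ.mkℚᵘ (ℤ.+ k) 0 ℚᵘ.≃ ℚ.toℚᵘ ((ℤ.+ k) ℚ./ 1)
  ≃/1 k = ℚᵘₚ.≃-sym (ℚₚ.toℚᵘ-fromℚᵘ (ℚᵘ.mkℚᵘ (ℤ.+ k) 0))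

module ParkingPolytope (em : ExcludedMiddle 0ℓ) where
  open ClassicalReals em
  open module O = OrderedRingProperties ℝ-orderedRing
    using (IsParking; StrictlyIncreasing; MaximalVertex)

  oneTo-strictlyIncreasing : ∀ n → StrictlyIncreasing (oneTo n)
  oneTo-strictlyIncreasing n = record
    { positive   = λ i → fromℚ-positive (ℕ/1-mono-< {0} {ℕ.suc (toℕ i)} ℕ.z<s)
    ; increasing = λ {i} {j} i<j →
        let p = (ℤ.+ ℕ.suc (toℕ i)) ℚ./ 1
            q = (ℤ.+ ℕ.suc (toℕ j)) ℚ./ 1
        in fromℚ (q ℚ.- p) ,
           fromℚ-positive (ℚ-diff (ℕ/1-mono-< (ℕ.s<s i<j))) ,
           pointwise-≈ {fromℚ q} {fromℚ p + fromℚ (q ℚ.- p)} λ _ →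
             solve 2 (λ p q → q := p :+ (q :- p)) ≡.refl p q
    }

  module _ {n : ℕ} where

    parking⇒ : ∀ {u a : ℝ^ n} → IsParking u a → a ∈ ParkingFunction u
    parking⇒ {u} {a} (0≤a , σ , sorted , below) =
      0≤a , a ∘ (σ ⟨$⟩ʳ_) , (σ , λ i → pointwise-≈ {a (σ ⟨$⟩ʳ i)} {a (σ ⟨$⟩ʳ i)} λ _ → ≡.refl) ,
      (λ {i} {j} → sorted {i} {j}) , below

    parking⇐ : ∀ {u a : ℝ^ n} → a ∈ ParkingFunction u → IsParking u a
    parking⇐ {u} {a} (0≤a , b , (π , b≈aπ) , b-mono , b≤u) = 0≤a , π ,
      (λ {i} {j} i≤j → ≤-trans {a (π ⟨$⟩ʳ i)} {b i} {a (π ⟨$⟩ʳ j)} (aπ≤b i)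
        (≤-trans {b i} {b j} {a (π ⟨$⟩ʳ j)} (b-mono i≤j) (≈⇒≤ {b j} {a (π ⟨$⟩ʳ j)} (b≈aπ j)))) ,
      (λ i → ≤-trans {a (π ⟨$⟩ʳ i)} {b i} {u i} (aπ≤b i) (b≤u i))
      where
      aπ≤b : ∀ i → a (π ⟨$⟩ʳ i) ≤ b i
      aπ≤b i = ≈⇒≤ {a (π ⟨$⟩ʳ i)} {b i} (≈-sym {b i} {a (π ⟨$⟩ʳ i)} (b≈aπ i))

    parking∈PF : ∀ {u a : ℝ^ n} → IsParking u a → a ∈ PF u
    parking∈PF {u} {a} parking = 1 , (λ _ → 1ℝ) , (λ _ → a) ,
      (λ _ → fromℚ-mono-≤ (ℚₚ.<⇒≤ (ℚₚ.positive⁻¹ 1ℚ))) ,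
      pointwise-≈ {1ℝ + 0ℝ} {1ℝ} (λ _ → ≡.refl) ,
      (λ _ → parking⇒ {u} {a} parking) ,
      λ i → pointwise-≈ {a i} {1ℝ * a i + 0ℝ} λ k →
        ≡.sym (≡.trans (ℚₚ.+-identityʳ (1ℚ ℚ.* seq (a i) k)) (ℚₚ.*-identityˡ (seq (a i) k)))

    PF-bound : ∀ {u : ℝ^ n} (w : ℝ^ n) c → (∀ {a : ℝ^ n} → IsParking u a → w · a ≤ c) →
      ∀ {x} → x ∈ PF u → w · x ≤ c
    PF-bound {u} w c bound {x} (m , t , v , 0≤t , ∑t≈1 , v-parking , x≈∑tv) =
      O.convex-bound {c = c} w x t v 0≤t ∑t≈1 x≈∑tv
        (λ j → bound {v j} (parking⇐ {u} {v j} (v-parking j)))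

    face : ∀ {w : ℝ^ n} → ℝ^ n → MaximalVertex w → Subset n
    face {w} e K = PF e ∩ λ x → w · x ≈ w · MaximalVertex.top K e

    module _ (u : ℝ^ n) (0≤u : ∀ i → 0ℝ ≤ u i) (u-mono : Nondecreasing u)
             {w : ℝ^ n} (K : MaximalVertex w) where
      open MaximalVertex K

      top∈PF : top u ∈ PF u
      top∈PF = parking∈PF {u} {top u} (top-parking {u} 0≤u (λ {i} {j} → u-mono {i} {j}))

      PF-top-maximal : ∀ {f : ℝ^ n} → Cone f → ∀ {x} → x ∈ PF u → f · x ≤ f · top u
      PF-top-maximal {f} f∈Cone {x} =
        PF-bound {u} f (f · top u) (λ {a} → top-maximal {f} {u} {a} f∈Cone) {x}

      top∈face : top u ∈ face u K
      top∈face = top∈PF , pointwise-≈ {w · top u} {w · top u} λ _ → ≡.refl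

      ncone-face-maximal : ∀ {w′ y : ℝ^ n} → w′ ∈ ncone (face u K) (PF u) →
        IsParking u y → w′ · y ≤ w′ · top u
      ncone-face-maximal {w′} {y} w′∈ y-parking =
        w′∈ {top u} {y} top∈face (parking∈PF {u} {y} y-parking)

      -- `y` ties with `top u` under `w` and so lies on the face; the cone condition is read with
      -- `y` as the face point and `top u` as its competitor.
      ncone-face-constant : ∀ {w′ y : ℝ^ n} → w′ ∈ ncone (face u K) (PF u) →
        IsParking u y → w · y ≈ w · top u → w′ · top u ≤ w′ · y
      ncone-face-constant {w′} {y} w′∈ y-parking wy≈ =
        w′∈ {y} {top u} (parking∈PF {u} {y} y-parking , wy≈) top∈PF

      face-normalCone : ncone (face u K) (PF u) ∈ NormalFan (PF u)
      face-normalCone = face u K ,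
        (w , w · top u , (λ {x} → PF-top-maximal {w} w∈Cone {x}) , id , id) ,
        (top u , top∈face) ,
        id , id

    -- Comparison of two normal fans

    module _ {e u : ℝ^ n} (e-strict : StrictlyIncreasing e)
             (0≤u : ∀ i → 0ℝ ≤ u i) (u-mono : Nondecreasing u) where
      private
        0≤e : ∀ i → 0ℝ ≤ e i
        0≤e = StrictlyIncreasing.e-nonneg e-strict
        e-mono : Nondecreasing e
        e-mono {i} {j} = StrictlyIncreasing.e-mono e-strict {i} {j}

      ∈ncone-face : ∀ {w : ℝ^ n} (K : MaximalVertex w) → w ∈ ncone (face e K) (PF e)
      ∈ncone-face {w} K {x} {y} (_ , wx≈) y∈PF =
        ≤-trans {w · y} {w · top e} {w · x} (PF-top-maximal e 0≤e (λ {i} {j} → e-mono {i} {j}) K {w} w∈Cone {y} y∈PF)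
          (≈⇒≤ {w · top e} {w · x} (≈-sym {w · x} {w · top e} wx≈))
        where open MaximalVertex K

      PF-face-inclusion : ∀ {w w′ x : ℝ^ n} (K : MaximalVertex w) →
        w′ ∈ ncone (face e K) (PF e) → x ∈ PF u →
        w · MaximalVertex.top K u ≤ w · x →
        MaximalVertex.Cone K w′ × w′ · MaximalVertex.top K u ≤ w′ · x
      PF-face-inclusion {w} {w′} {x} K w′∈ x∈PF =
        MaximalVertex.face-inclusion K {e} {w′} {u} {x} e-strict
          (λ {y} → ncone-face-maximal e 0≤e (λ {i} {j} → e-mono {i} {j}) K {w′} {y}
            (λ {x} {y} → w′∈ {x} {y}))
          (λ {y} → ncone-face-constant e 0≤e (λ {i} {j} → e-mono {i} {j}) K {w′} {y}
            (λ {x} {y} → w′∈ {x} {y}))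
          (λ {f} f∈Cone →
            PF-top-maximal u 0≤u (λ {i} {j} → u-mono {i} {j}) K {f} f∈Cone {x} x∈PF)

      -- Because `w` lies in the normal cone at `F`, each `x` in `F` has `w · top u ≤ w · x`.
      -- `PF-face-inclusion` passes this inequality on to `w′`, whose maximum over `PF u` is
      -- attained at `top u` by `w′∈Cone`.
      ncone-face⊆ncone : ∀ {F : Subset n} {w w′ : ℝ^ n} (K : MaximalVertex w) →
        F ⊆ PF u → w ∈ ncone F (PF u) →
        w′ ∈ ncone (face e K) (PF e) → w′ ∈ ncone F (PF u)
      ncone-face⊆ncone {F} {w} {w′} K F⊆PF w∈ w′∈ {x} {y} x∈F y∈PF =
        let w′∈Cone , top≤x = PF-face-inclusion {w} {w′} {x} K (λ {x} {y} → w′∈ {x} {y}) (F⊆PF {x} x∈F)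
              (w∈ {x} {MaximalVertex.top K u} x∈F
                (top∈PF u 0≤u (λ {i} {j} → u-mono {i} {j}) K))
        in ≤-trans {w′ · y} {w′ · MaximalVertex.top K u} {w′ · x}
             (PF-top-maximal u 0≤u (λ {i} {j} → u-mono {i} {j}) K {w′} w′∈Cone {y} y∈PF) top≤x

      PF-coarsening : NormalFan (PF u) IsCoarseningOf NormalFan (PF e)
      PF-coarsening {C} (F , (_ , _ , _ , F⊆ , _) , _ , C⊆ , ⊆C) =
        -- The members of `C` index their own covering: `w` contributes the normal cone at the
        -- `w`-maximal face of `PF e`, which contains `w` by `∈ncone-face` and stays inside `C` by
        -- `ncone-face⊆ncone`.
        (∃ λ w → w ∈ C) , (λ (w , _) → ncone (face e (O.maximalVertex w)) (PF e)) ,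
        (λ (w , _) → face-normalCone e 0≤e (λ {i} {j} → e-mono {i} {j}) (O.maximalVertex w)) ,
        (λ {w} w∈C → (w , w∈C) , λ {x} {y} → ∈ncone-face (O.maximalVertex w) {x} {y}) ,
        (λ {w′} ((w , w∈C) , w′∈) → ⊆C {w′} λ {x} {y} →
          ncone-face⊆ncone {F} {w} {w′} (O.maximalVertex w)
            (λ {x} x∈F → proj₁ (F⊆ {x} x∈F))
            (λ {x} {y} → C⊆ {w} w∈C {x} {y}) (λ {x} {y} → w′∈ {x} {y}) {x} {y})

proposition1p1 : ExcludedMiddle 0ℓ →
    (n : ℕ) → 1 ℕ.≤ n →
    (u : ℝ^ n) → ¬ (∀ i → u i ≈ 0ℝ) → (∀ i → 0ℝ ≤ u i) → Nondecreasing u →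
    (NormalFan (PF u) IsCoarseningOf NormalFan (PF (oneTo n)))
    × (PF u IsDeformationOf PF (oneTo n))
proposition1p1 em n _ u _ 0≤u u-mono =
  -- A deformation is by definition a coarsening of normal fans, so one proof serves for both
  -- components.
  (λ {C} → coarsening {C}) , (λ {C} → coarsening {C})
  where
  open ParkingPolytope em
  coarsening : NormalFan (PF u) IsCoarseningOf NormalFan (PF (oneTo n))
  coarsening {C} = PF-coarsening {e = oneTo n} {u} (oneTo-strictlyIncreasing n) 0≤u
    (λ {i} {j} → u-mono {i} {j}) {C}
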